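{- Let $\alpha$ be an infinite ordinal. The equational theory of $\mathsf{RCA}_\alpha$ is the least set of equations (in the language of $\mathsf{CA}_\alpha$) which contains the cylindric axioms defining $\mathsf{CA}_\alpha$, is closed under the five rules of equational logic, and is closed under the inductive rule.
   Context: The language of $\mathsf{CA}_\alpha$ has Boolean operations $+,-$, unary operations $c_i$ ($i\in\alpha$) and constants $d_{ij}$ ($i,j\in\alpha$). The cylindric axioms defining $\mathsf{CA}_\alpha$ are: equational axioms saying that $\langle A,+,-\rangle$ is a Boolean algebra, and for all distinct $i,j,k\in\alpha$: $c_ic_jx=c_jc_ix$, $x\le c_ix=c_ic_ix$, $c_i(x+y)=c_ix+c_iy$, $c_i-c_ix=-c_ix$, $d_{ii}=1$, $d_{ij}=d_{ji}$, $c_j(d_{ij}\cdot d_{jk})=d_{ik}$, $c_id_{ij}=1$, $d_{ij}\cdot c_i(d_{ij}\cdot x)=d_{ij}\cdot x$. For $V\subseteq{}^\alpha U$, the full cylindric set algebra with unit $V$ is $\langle \mathcal P(V),\cup,-,C_i^V,D_{ij}^V : i,j\in\alpha\rangle$, where $C_i^VX=\{s(i/u)\in V : s\in X,\ u\in U\}$ ($s(i/u)$ is $s$ with its value at $i$ changed to $u$) and $D_{ij}^V=\{s\in V : s_i=s_j\}$. $\mathsf{RCA}_\alpha$ is the class of all algebras isomorphic to subalgebras of full cylindric set algebras whose unit is a disjoint union of sets of the form ${}^\alpha U$. Equations use a fixed countably infinite set of variables. The equational theory of a class is the set of all equations valid in all its members. The five rules of equational logic are the usual ones of Birkhoff's complete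 calculus: reflexivity, symmetry, transitivity, replacement (congruence) and substitution. The inductive rule is: from $e(c_ix_1,\dots,c_ix_n)$ infer $e(x_1,\dots,x_n)$, where $e$ is an equation with variables $x_1,\dots,x_n$ and $i\in\alpha$ is not an index of any operation occurring in $e$ (i.e. neither $c_i$ nor any $d_{ij}$, $d_{ji}$ occurs in $e$). -}

module Defs where

open import Algebra.Core using (Op₁; Op₂)
open import Algebra.Definitions using (Congruent₁; Congruent₂)
open import Data.Bool.Base using (if_then_else_)
open import Data.Fin.Base using (Fin)
open import Data.Nat.Base using (ℕ)
open import Data.Product.Base using (Σ; Σ-syntax; ∃-syntax; _×_; _,_; proj₁; proj₂)
open import Data.Sum.Base using (_⊎_; inj₁; inj₂)
open import Function.Base using (_∘_)
open import Function.Bundles using (Bijection; _↔_)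
open import Induction.WellFounded using (WellFounded)
open import Level using (Level; suc; _⊔_)
open import Relation.Binary.Bundles using (Setoid)
open import Relation.Binary.Core using (Rel)
open import Relation.Binary.Definitions using (_Respects_)
open import Relation.Binary.PropositionalEquality
  using (_≡_; _≢_; _≗_; refl; sym; trans)
open import Relation.Binary.Structures using (IsStrictTotalOrder)
open import Relation.Nullary using (¬_; does)
open import Relation.Unary
  using (Pred; _∈_; _⊆_; _≐_; _∩_; _∪_; _∖_; Empty; ⋃)
open import Relation.Unary.Properties using (≐-refl; ≐-sym; ≐-trans)
import Relation.Binary.Construct.On as On

-- An ordinal is given as a well-ordered type.

record Ordinal (ℓ : Level) : Set (suc ℓ) where
  infix 4 _<_
  field
    Index              : Set ℓ
    _<_                : Rel Index ℓ
    isStrictTotalOrder : IsStrictTotalOrder _≡_ _<_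
    wellFounded        : WellFounded _<_

  open IsStrictTotalOrder isStrictTotalOrder public using (_≟_)

open Ordinal using (Index)

Infinite : ∀ {ℓ} → Ordinal ℓ → Set ℓ
Infinite α = ¬ (∃[ n ] Index α ↔ Fin n)

module _ {ℓ : Level} (α : Ordinal ℓ) where

  infix  8 -_
  infixl 6 _+_
  infix  4 _≈_

  data Term : Set ℓ where
    var : ℕ → Term
    _+_ : Term → Term → Term
    -_  : Term → Term
    c   : Index α → Term → Term
    d   : Index α → Index α → Term

  data Equation : Set ℓ where
    _≈_ : Term → Term → Equation

module _ {ℓ : Level} {α : Ordinal ℓ} where

  infixl 7 _·_
  infix  4 _≤_

  _·_ : Term α → Term α → Term α
  s · t = - (- s + - t)

  _≤_ : Term α → Term α → Equation α
  s ≤ t = s + t ≈ t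

  -- The signature has no constant for the unit.  As 𝟙 and 𝟘 contain var 0,
  -- the complement laws below are stated for var 1, so that they also say that
  -- the unit and zero do not depend on the variable chosen.
  𝟙 𝟘 : Term α
  𝟙 = var 0 + - var 0
  𝟘 = - 𝟙

  _[_] : Term α → (ℕ → Term α) → Term α
  var n   [ σ ] = σ n
  (s + t) [ σ ] = (s [ σ ]) + (t [ σ ])
  (- t)   [ σ ] = - (t [ σ ])
  c i t   [ σ ] = c i (t [ σ ])
  d i j   [ σ ] = d i j

  infix 4 _occursIn_ _occursInEq_

  data _occursIn_ (i : Index α) : Term α → Set ℓ where
    in-+ˡ : ∀ {s t} → i occursIn s → i occursIn (s + t)
    in-+ʳ : ∀ {s t} → i occursIn t → i occursIn (s + t)
    in--  : ∀ {t} → i occursIn t → i occursIn (- t)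
    at-c  : ∀ {t} → i occursIn c i t
    in-c  : ∀ {j t} → i occursIn t → i occursIn c j t
    at-dˡ : ∀ {j} → i occursIn d i j
    at-dʳ : ∀ {j} → i occursIn d j i

  _occursInEq_ : Index α → Equation α → Set ℓ
  i occursInEq (s ≈ t) = i occursIn s ⊎ i occursIn t

module _ {ℓ : Level} (α : Ordinal ℓ) where

  private
    x y z : Term α
    x = var 0
    y = var 1
    z = var 2

  data BooleanAxiom : Pred (Equation α) ℓ where
    +-comm       : BooleanAxiom (x + y ≈ y + x)
    +-assoc      : BooleanAxiom ((x + y) + z ≈ x + (y + z))
    ·-comm       : BooleanAxiom (x · y ≈ y · x)
    ·-assoc      : BooleanAxiom ((x · y) · z ≈ x · (y · z))
    +-absorbs-·  : BooleanAxiom (x + (x · y) ≈ x)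
    ·-absorbs-+  : BooleanAxiom (x · (x + y) ≈ x)
    +-distrib-·  : BooleanAxiom (x + (y · z) ≈ (x + y) · (x + z))
    ·-distrib-+  : BooleanAxiom (x · (y + z) ≈ (x · y) + (x · z))
    +-complement : BooleanAxiom (y + - y ≈ 𝟙)
    ·-complement : BooleanAxiom (y · - y ≈ 𝟘)

  data CylindricAxiom : Pred (Equation α) ℓ where
    boolean : ∀ {e} → BooleanAxiom e → CylindricAxiom e
    c-comm  : ∀ {i j} → i ≢ j → CylindricAxiom (c i (c j x) ≈ c j (c i x))
    c-incr  : ∀ {i} → CylindricAxiom (x ≤ c i x)
    c-idem  : ∀ {i} → CylindricAxiom (c i x ≈ c i (c i x))
    c-+     : ∀ {i} → CylindricAxiom (c i (x + y) ≈ c i x + c i y)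
    c--     : ∀ {i} → CylindricAxiom (c i (- c i x) ≈ - c i x)
    d-refl  : ∀ {i} → CylindricAxiom (d i i ≈ 𝟙)
    d-sym   : ∀ {i j} → i ≢ j → CylindricAxiom (d i j ≈ d j i)
    d-trans : ∀ {i j k} → i ≢ j → j ≢ k → i ≢ k →
              CylindricAxiom (c j (d i j · d j k) ≈ d i k)
    c-d     : ∀ {i j} → i ≢ j → CylindricAxiom (c i (d i j) ≈ 𝟙)
    d-c     : ∀ {i j} → i ≢ j →
              CylindricAxiom (d i j · c i (d i j · x) ≈ d i j · x)

module _ {ℓ t : Level} {α : Ordinal ℓ} (T : Pred (Equation α) t) where

  record ClosedUnderEquationalLogic : Set (ℓ ⊔ t) where
    field
      reflexivity  : ∀ {s} → T (s ≈ s)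
      symmetry     : ∀ {s u} → T (s ≈ u) → T (u ≈ s)
      transitivity : ∀ {s u v} → T (s ≈ u) → T (u ≈ v) → T (s ≈ v)
      replace-+    : ∀ {s s′ u u′} → T (s ≈ s′) → T (u ≈ u′) → T (s + u ≈ s′ + u′)
      replace--    : ∀ {s s′} → T (s ≈ s′) → T (- s ≈ - s′)
      replace-c    : ∀ {i s s′} → T (s ≈ s′) → T (c i s ≈ c i s′)
      substitution : ∀ {s u} (σ : ℕ → Term α) → T (s ≈ u) → T ((s [ σ ]) ≈ (u [ σ ]))

  ClosedUnderInductiveRule : Set (ℓ ⊔ t)
  ClosedUnderInductiveRule = ∀ {s u i} → ¬ (i occursInEq (s ≈ u)) →
    T ((s [ (λ n → c i (var n)) ]) ≈ (u [ (λ n → c i (var n)) ])) → T (s ≈ u)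

  record IsInductiveCylindricTheory : Set (ℓ ⊔ t) where
    field
      axioms           : CylindricAxiom α ⊆ T
      equational-logic : ClosedUnderEquationalLogic
      inductive-rule   : ClosedUnderInductiveRule

record Algebra {ℓ} (α : Ordinal ℓ) (a e : Level) : Set (ℓ ⊔ suc (a ⊔ e)) where
  field
    setoid : Setoid a e
  open Setoid setoid public renaming (_≈_ to _≈ᴬ_)
  field
    add    : Op₂ Carrier
    neg    : Op₁ Carrier
    cyl    : Index α → Op₁ Carrier
    diag   : Index α → Index α → Carrier
    add-cong : Congruent₂ _≈ᴬ_ add
    neg-cong : Congruent₁ _≈ᴬ_ neg
    cyl-cong : ∀ i → Congruent₁ _≈ᴬ_ (cyl i)

  ⟦_⟧ : Term α → (ℕ → Carrier) → Carrier
  ⟦ var n ⟧ ρ = ρ n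
  ⟦ s + t ⟧ ρ = add (⟦ s ⟧ ρ) (⟦ t ⟧ ρ)
  ⟦ - t ⟧   ρ = neg (⟦ t ⟧ ρ)
  ⟦ c i t ⟧ ρ = cyl i (⟦ t ⟧ ρ)
  ⟦ d i j ⟧ ρ = diag i j

module _ {ℓ : Level} {α : Ordinal ℓ} where

  infix 4 _⊨_ _≅_

  _⊨_ : ∀ {a e} → Algebra α a e → Equation α → Set (a ⊔ e)
  A ⊨ (s ≈ t) = ∀ ρ → ⟦ s ⟧ ρ ≈ᴬ ⟦ t ⟧ ρ
    where open Algebra A

  EqTheory : ∀ {a e k} → Pred (Algebra α a e) k →
             Pred (Equation α) (ℓ ⊔ suc (a ⊔ e) ⊔ k)
  EqTheory K ε = ∀ A → A ∈ K → A ⊨ ε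

  record _≅_ {a e a′ e′} (A : Algebra α a e) (B : Algebra α a′ e′) :
             Set (ℓ ⊔ a ⊔ e ⊔ a′ ⊔ e′) where
    private
      module A = Algebra A
      module B = Algebra B
    field
      bijection : Bijection A.setoid B.setoid
    open Bijection bijection public using (to)
    field
      add-homo  : ∀ x y → to (A.add x y) B.≈ᴬ B.add (to x) (to y)
      neg-homo  : ∀ x → to (A.neg x) B.≈ᴬ B.neg (to x)
      cyl-homo  : ∀ i x → to (A.cyl i x) B.≈ᴬ B.cyl i (to x)
      diag-homo : ∀ i j → to (A.diag i j) B.≈ᴬ B.diag i j

  record IsSubuniverse {a e p} (A : Algebra α a e) (S : Pred (Algebra.Carrier A) p) :
                       Set (ℓ ⊔ a ⊔ e ⊔ p) where
    open Algebra A
    field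
      respects    : S Respects _≈ᴬ_
      add-closed  : ∀ {x y} → x ∈ S → y ∈ S → add x y ∈ S
      neg-closed  : ∀ {x} → x ∈ S → neg x ∈ S
      cyl-closed  : ∀ {i x} → x ∈ S → cyl i x ∈ S
      diag-closed : ∀ {i j} → diag i j ∈ S

  subalgebra : ∀ {a e p} (A : Algebra α a e) {S : Pred (Algebra.Carrier A) p} →
               IsSubuniverse A S → Algebra α (a ⊔ p) e
  subalgebra A {S} sub = record
    { setoid   = On.setoid {B = Σ Carrier S} setoid proj₁
    ; add      = λ (x , p) (y , q) → add x y , add-closed p q
    ; neg      = λ (x , p) → neg x , neg-closed p
    ; cyl      = λ i (x , p) → cyl i x , cyl-closed p
    ; diag     = λ i j → diag i j , diag-closed
    ; add-cong = add-cong
    ; neg-cong = neg-cong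
    ; cyl-cong = λ i → cyl-cong i
    }
    where
    open Algebra A
    open IsSubuniverse sub

module _ {ℓ : Level} (α : Ordinal ℓ) (U : Set ℓ) where

  Seq : Set ℓ
  Seq = Index α → U

  -- In the absence of function extensionality, sequences are compared
  -- pointwise, so sets of sequences are predicates respecting _≗_.

  record SeqSet : Set (suc ℓ) where
    field
      holds    : Pred Seq ℓ
      respects : holds Respects _≗_

module _ {ℓ : Level} {α : Ordinal ℓ} {U : Set ℓ} where

  open Ordinal α using (_≟_)
  open SeqSet

  _⟨_≔_⟩ : Seq α U → Index α → U → Seq α U
  (s ⟨ i ≔ u ⟩) j = if does (j ≟ i) then u else s j

  -- The elements of 𝒫 V, for V ⊆ ᵅU.

  record SubsetOf (V : SeqSet α U) : Set (suc ℓ) where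
    field
      set      : SeqSet α U
      included : holds set ⊆ holds V

    members : Pred (Seq α U) ℓ
    members = holds set

  open SubsetOf

  module _ (V : SeqSet α U) where

    union : Op₂ (SubsetOf V)
    union X Y = record
      { set = record
        { holds    = members X ∪ members Y
        ; respects = λ { eq (inj₁ p) → inj₁ (respects (set X) eq p)
                       ; eq (inj₂ q) → inj₂ (respects (set Y) eq q) }
        }
      ; included = λ { (inj₁ p) → included X p ; (inj₂ q) → included Y q }
      }

    complement : Op₁ (SubsetOf V)
    complement X = record
      { set = record
        { holds    = holds V ∖ members X
        ; respects = λ eq (v , ¬p) →
            respects V eq v , ¬p ∘ respects (set X) (λ i → sym (eq i))
        }
      ; included = proj₁
      }

    cylindrify : Index α → Op₁ (SubsetOf V)
    cylindrify i X = record
      { set = record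
        { holds    = λ t → t ∈ holds V ×
                     (Σ[ s ∈ Seq α U ] s ∈ members X × (Σ[ u ∈ U ] t ≗ s ⟨ i ≔ u ⟩))
        ; respects = λ eq (v , s , p , u , t≗) →
            respects V eq v , s , p , u , λ j → trans (sym (eq j)) (t≗ j)
        }
      ; included = proj₁
      }

    diagonal : Index α → Index α → SubsetOf V
    diagonal i j = record
      { set = record
        { holds    = λ s → s ∈ holds V × s i ≡ s j
        ; respects = λ eq (v , p) →
            respects V eq v , trans (sym (eq i)) (trans p (eq j))
        }
      ; included = proj₁
      }

    fullSetAlgebra : Algebra α (suc ℓ) ℓ
    fullSetAlgebra = record
      { setoid = record
        { Carrier       = SubsetOf V
        ; _≈_           = λ X Y → members X ≐ members Y
        ; isEquivalence = record { refl = ≐-refl ; sym = ≐-sym ; trans = ≐-trans }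
        }
      ; add      = union
      ; neg      = complement
      ; cyl      = cylindrify
      ; diag     = diagonal
      ; add-cong = λ (f , f⁻) (g , g⁻) →
          (λ { (inj₁ p) → inj₁ (f p) ; (inj₂ q) → inj₂ (g q) }) ,
          (λ { (inj₁ p) → inj₁ (f⁻ p) ; (inj₂ q) → inj₂ (g⁻ q) })
      ; neg-cong = λ (f , f⁻) →
          (λ (v , ¬p) → v , ¬p ∘ f⁻) , (λ (v , ¬p) → v , ¬p ∘ f)
      ; cyl-cong = λ i (f , f⁻) →
          (λ (v , s , p , q) → v , s , f p , q) ,
          (λ (v , s , p , q) → v , s , f⁻ p , q)
      }

  power : Pred U ℓ → SeqSet α U
  power W = record
    { holds    = λ s → ∀ i → s i ∈ W
    ; respects = λ eq p i → subst-∈ (eq i) (p i)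
    }
    where
    subst-∈ : ∀ {u v} → u ≡ v → u ∈ W → v ∈ W
    subst-∈ refl p = p

  unionOfPowers : (K : Set ℓ) → (K → Pred U ℓ) → SeqSet α U
  unionOfPowers K W = record
    { holds    = ⋃ K (λ k → holds (power (W k)))
    ; respects = λ eq (k , p) → k , respects (power (W k)) eq p
    }

  PairwiseDisjointPowers : (K : Set ℓ) → (K → Pred U ℓ) → Set ℓ
  PairwiseDisjointPowers K W = ∀ {k l} → k ≢ l →
    Empty (holds (power (W k)) ∩ holds (power (W l)))

-- The base sets and index sets of units range over Set ℓ, the universe of α;
-- their power sets, and so the algebras of the class, are then in Set (suc ℓ).

record RCA {ℓ} (α : Ordinal ℓ) (A : Algebra α (suc ℓ) ℓ) : Set (suc (suc ℓ)) where
  field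
    U           : Set ℓ
    K           : Set ℓ
    W           : K → Pred U ℓ
    disjoint    : PairwiseDisjointPowers {α = α} K W

  full : Algebra α (suc ℓ) ℓ
  full = fullSetAlgebra (unionOfPowers K W)

  field
    S           : Pred (Algebra.Carrier full) (suc ℓ)
    isSub       : IsSubuniverse full S
    isomorphism : A ≅ subalgebra full isSub

{-# OPTIONS --safe #-}
module Submission where

-- Soundness of the inductive rule.  Since α is infinite, there is an injection
-- f of α into itself which fixes the indices of the equation and misses i.
-- Replacing every set X by {s : s ∘ f ∈ X} commutes with the terms of the
-- equation, is injective, and yields sets closed under Cᵢ.  So an equation which
-- fails at some X₁, …, Xₙ also fails when cᵢx₁, …, cᵢxₙ are substituted.
--
-- Completeness.  Let s ≈ t have its indices among g 0, …, g (k - 1), where g is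
-- an injection of ω into α.  By the inductive rule nothing new about s and t
-- becomes derivable if the variables are assumed to be closed under all c (g n)
-- with n ≥ k.  The terms over g then form a countable locally finite cylindric
-- algebra, in which every element other than zero lies in an ultrafilter with
-- Henkin witnesses.  The indices from k on serve as constants: an assignment τ
-- of constants to the indices below k satisfies a term iff the ultrafilter
-- contains the result of substituting τ in it.

open import Defs
open import Algebra.Consequences.Setoid using (comm∧distrˡ⇒distr; comm∧invʳ⇒inv)
open import Algebra.Core using (Op₁)
open import Algebra.Definitions using (Congruent₁)
open import Algebra.Lattice.Bundles using (BooleanAlgebra)
import Algebra.Lattice.Properties.BooleanAlgebra as BooleanAlgebraProperties
open import Axiom.ExcludedMiddle using (ExcludedMiddle)
open import Data.Fin.Base using (zero; suc)
open import Data.List.Base using (List; []; _∷_; _++_; length; lookup; deduplicate)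
open import Data.List.Membership.Propositional using () renaming (_∈_ to _∈ₗ_; _∉_ to _∉ₗ_)
open import Data.List.Membership.Propositional.Properties
  using (∈-deduplicate⁺; ∈-lookup; ∈-++⁺ˡ; ∈-++⁺ʳ; ∈-++⁻)
open import Data.List.Relation.Unary.All as All using ()
open import Data.List.Relation.Unary.AllPairs using (_∷_)
open import Data.List.Relation.Unary.Any as Any using (here; there)
open import Data.List.Relation.Unary.Any.Properties using (lookup-index)
open import Data.List.Relation.Unary.Unique.DecPropositional.Properties using (deduplicate-!)
open import Data.List.Relation.Unary.Unique.Propositional using (Unique)
open import Data.Nat.Base as ℕ using (ℕ; zero; suc; _⊔_; _∸_)
open import Data.Nat.Induction using (<-rec; <-wellFounded)
import Data.Nat.Properties as ℕ
open import Data.Product.Base using (_×_; _,_; proj₁; proj₂; Σ-syntax; ∃-syntax)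
open import Data.Sum.Base using (_⊎_; inj₁; inj₂; [_,_]′)
import Data.Unit.Base as Unit
open import Function.Base using (_∘_)
open import Function.Bundles using (Bijection; mk↔ₛ′)
open import Function.Definitions using (Injective)
open import Level using (Level; 0ℓ; Lift; lift; lower) renaming (suc to lsuc; _⊔_ to _⊔ₗ_)
open import Relation.Binary.Bundles using (Setoid)
open import Relation.Binary.Definitions using (DecidableEquality; tri<; tri≈; tri>)
import Relation.Binary.Lattice.Bundles as Order
import Relation.Binary.Reasoning.PartialOrder as PosetReasoning
import Relation.Binary.Reasoning.Setoid as SetoidReasoning
open import Relation.Binary.PropositionalEquality as ≡ using (_≡_; _≢_; _≗_)
open import Relation.Nullary using (¬_; yes; no; contradiction)
open import Relation.Nullary.Decidable using (decidable-stable)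
open import Relation.Unary using (Pred; _∈_; _⊆_)

open Ordinal using (Index)

-- Arithmetic of cylindric algebras.

record CylindricAlgebra {i : Level} (I : Set i) (b ℓ : Level) : Set (i ⊔ₗ lsuc (b ⊔ₗ ℓ)) where
  field
    _≟_            : DecidableEquality I
    booleanAlgebra : BooleanAlgebra b ℓ
  open BooleanAlgebra booleanAlgebra public
    renaming (_≈_ to _≋_; _≉_ to _≭_; ¬_ to ∼_; ¬-cong to ∼-cong)
  field
    cyl        : I → Op₁ Carrier
    diag       : I → I → Carrier
    cyl-cong   : ∀ i → Congruent₁ _≋_ (cyl i)
    cyl-comm   : ∀ {i j} → i ≢ j → ∀ x → cyl i (cyl j x) ≋ cyl j (cyl i x)
    cyl-incr   : ∀ i x → x ∨ cyl i x ≋ cyl i x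
    cyl-idem   : ∀ i x → cyl i x ≋ cyl i (cyl i x)
    cyl-∨      : ∀ i x y → cyl i (x ∨ y) ≋ cyl i x ∨ cyl i y
    cyl-∼      : ∀ i x → cyl i (∼ cyl i x) ≋ ∼ cyl i x
    diag-refl  : ∀ i → diag i i ≋ ⊤
    diag-sym   : ∀ {i j} → i ≢ j → diag i j ≋ diag j i
    diag-trans : ∀ {i j k} → i ≢ j → j ≢ k → i ≢ k → cyl j (diag i j ∧ diag j k) ≋ diag i k
    cyl-diag   : ∀ {i j} → i ≢ j → cyl i (diag i j) ≋ ⊤
    diag-cyl   : ∀ {i j} → i ≢ j → ∀ x → diag i j ∧ cyl i (diag i j ∧ x) ≋ diag i j ∧ x

  private module B = BooleanAlgebraProperties booleanAlgebra
  private module L = Order.Lattice B.∨-∧-orderTheoreticLattice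
  open L public using () renaming (_≤_ to _⊑_; antisym to ⊑-antisym; reflexive to ⊑-reflexive;
    refl to ⊑-refl; trans to ⊑-trans)
  open B public using (∧-identityʳ; ∧-identityˡ; ∨-identityʳ; ∨-identityˡ; ∧-zeroʳ; ∧-zeroˡ; ∧-idem)
  open PosetReasoning L.poset

  ∼-unique : ∀ {x y} → x ∨ y ≋ ⊤ → x ∧ y ≋ ⊥ → y ≋ ∼ x
  ∼-unique {x} {y} x∨y x∧y = begin-equality
    y                    ≈⟨ ∧-identityʳ y ⟨
    y ∧ ⊤                ≈⟨ ∧-congˡ (∨-complementʳ x) ⟨
    y ∧ (x ∨ ∼ x)        ≈⟨ ∧-distribˡ-∨ y x (∼ x) ⟩
    y ∧ x ∨ y ∧ ∼ x      ≈⟨ ∨-congʳ (trans (trans (∧-comm y x) x∧y) (sym (∧-complementʳ x))) ⟩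
    x ∧ ∼ x ∨ y ∧ ∼ x    ≈⟨ ∧-distribʳ-∨ (∼ x) x y ⟨
    (x ∨ y) ∧ ∼ x        ≈⟨ ∧-congʳ x∨y ⟩
    ⊤ ∧ ∼ x              ≈⟨ ∧-identityˡ (∼ x) ⟩
    ∼ x                  ∎

  -- The order `⊑` of the underlying lattice is x ≋ x ∧ y, while the cylindric axioms express
  -- inequalities through joins; this lemma and the next pass between the two forms.
  ∨⇒⊑ : ∀ {x y} → x ∨ y ≋ y → x ⊑ y
  ∨⇒⊑ {x} {y} x∨y = ⊑-trans (L.x≤x∨y x y) (⊑-reflexive x∨y)

  ⊑⇒∨ : ∀ {x y} → x ⊑ y → x ∨ y ≋ y
  ⊑⇒∨ x⊑y = ⊑-antisym (L.∨-least x⊑y ⊑-refl) (L.y≤x∨y _ _)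

  ⊥-min : ∀ x → ⊥ ⊑ x
  ⊥-min x = sym (∧-zeroˡ x)

  ⊤-max : ∀ x → x ⊑ ⊤
  ⊤-max x = sym (∧-identityʳ x)

  ⊑⊥⇒≋⊥ : ∀ {x} → x ⊑ ⊥ → x ≋ ⊥
  ⊑⊥⇒≋⊥ x⊑⊥ = ⊑-antisym x⊑⊥ (⊥-min _)

  ∧-⊥⇒⊑∼ : ∀ {x y} → x ∧ y ≋ ⊥ → x ⊑ ∼ y
  ∧-⊥⇒⊑∼ {x} {y} x∧y = begin
    x                ≈⟨ ∧-identityʳ x ⟨
    x ∧ ⊤            ≈⟨ ∧-congˡ (∨-complementʳ y) ⟨
    x ∧ (y ∨ ∼ y)    ≈⟨ ∧-distribˡ-∨ x y (∼ y) ⟩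
    x ∧ y ∨ x ∧ ∼ y  ≈⟨ trans (∨-congʳ x∧y) (∨-identityˡ _) ⟩
    x ∧ ∼ y          ≤⟨ L.x∧y≤y x (∼ y) ⟩
    ∼ y              ∎

  ∧-∼-⊥⇒⊑ : ∀ {x y} → x ∧ ∼ y ≋ ⊥ → x ⊑ y
  ∧-∼-⊥⇒⊑ {x} {y} x∧∼y = ⊑-trans (∧-⊥⇒⊑∼ x∧∼y)
    (⊑-reflexive (sym (∼-unique (∨-complementˡ y) (∧-complementˡ y))))

  ∧-mono : ∀ {x x′ y y′} → x ⊑ x′ → y ⊑ y′ → x ∧ y ⊑ x′ ∧ y′
  ∧-mono p q = L.∧-greatest (⊑-trans (L.x∧y≤x _ _) p) (⊑-trans (L.x∧y≤y _ _) q)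

  open L public using (x≤x∨y; y≤x∨y; x∧y≤x; x∧y≤y; ∧-greatest; ∨-least)

  cyl-incr-⊑ : ∀ i x → x ⊑ cyl i x
  cyl-incr-⊑ i x = ∨⇒⊑ (cyl-incr i x)

  cyl-mono : ∀ i {x y} → x ⊑ y → cyl i x ⊑ cyl i y
  cyl-mono i {x} {y} x⊑y = ∨⇒⊑ (trans (sym (cyl-∨ i x y)) (cyl-cong i (⊑⇒∨ x⊑y)))

  cyl-⊤ : ∀ i → cyl i ⊤ ≋ ⊤
  cyl-⊤ i = ⊑-antisym (⊤-max _) (cyl-incr-⊑ i ⊤)

  -- In the usual terms, i does not belong to the dimension set of x: as a set of sequences, x does
  -- not depend on coordinate i.
  Closed : I → Carrier → Set ℓ
  Closed i x = cyl i x ≋ x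

  cyl-closed : ∀ i x → Closed i (cyl i x)
  cyl-closed i x = sym (cyl-idem i x)

  Closed-resp : ∀ {i x y} → x ≋ y → Closed i x → Closed i y
  Closed-resp {i} x≋y cx = trans (cyl-cong i (sym x≋y)) (trans cx x≋y)

  ∼-closed : ∀ {i x} → Closed i x → Closed i (∼ x)
  ∼-closed {i} {x} cx = Closed-resp (∼-cong cx) (cyl-∼ i x)

  ∨-closed : ∀ {i x y} → Closed i x → Closed i y → Closed i (x ∨ y)
  ∨-closed {i} {x} {y} cx cy = trans (cyl-∨ i x y) (∨-cong cx cy)

  ⊤-closed : ∀ {i} → Closed i ⊤
  ⊤-closed = cyl-⊤ _

  ⊥-closed : ∀ {i} → Closed i ⊥
  ⊥-closed = Closed-resp
    (sym (∼-unique (∨-identityʳ ⊤) (∧-zeroʳ ⊤))) (∼-closed ⊤-closed)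

  cyl-commute : ∀ i j x → cyl i (cyl j x) ≋ cyl j (cyl i x)
  cyl-commute i j x with i ≟ j
  ... | yes ≡.refl = refl
  ... | no i≢j     = cyl-comm i≢j x

  cyl-preserves-closed : ∀ {i} j {x} → Closed i x → Closed i (cyl j x)
  cyl-preserves-closed {i} j {x} cx = trans (cyl-commute i j x) (cyl-cong j cx)

  -- For the inequality from right to left, x is split into its parts inside y and inside `∼ y`.
  -- Since `∼ y` is closed too, the second part stays below `∼ y` under `cyl i` and vanishes on
  -- meeting y.
  cyl-∧-closed : ∀ {i} x {y} → Closed i y → cyl i (x ∧ y) ≋ cyl i x ∧ y
  cyl-∧-closed {i} x {y} cy = ⊑-antisym
    (∧-greatest (cyl-mono i (x∧y≤x x y)) (⊑-trans (cyl-mono i (x∧y≤y x y)) (⊑-reflexive cy)))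
    (begin
      cyl i x ∧ y                                  ≈⟨ ∧-congʳ (cyl-cong i split) ⟩
      cyl i (x ∧ y ∨ x ∧ ∼ y) ∧ y                  ≈⟨ ∧-congʳ (cyl-∨ i _ _) ⟩
      (cyl i (x ∧ y) ∨ cyl i (x ∧ ∼ y)) ∧ y        ≤⟨ ∧-mono (∨-least (x≤x∨y _ _)
                                                        (⊑-trans (cyl-mono i (x∧y≤y x (∼ y)))
                                                          (⊑-trans (⊑-reflexive (∼-closed cy)) (y≤x∨y _ _)))) ⊑-refl ⟩
      (cyl i (x ∧ y) ∨ ∼ y) ∧ y                    ≈⟨ ∧-distribʳ-∨ y _ _ ⟩
      cyl i (x ∧ y) ∧ y ∨ ∼ y ∧ y                  ≈⟨ trans (∨-congˡ (∧-complementˡ y)) (∨-identityʳ _) ⟩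
      cyl i (x ∧ y) ∧ y                            ≤⟨ x∧y≤x _ _ ⟩
      cyl i (x ∧ y)                                ∎)
    where
    split : x ≋ x ∧ y ∨ x ∧ ∼ y
    split = trans (sym (∧-identityʳ x)) (trans (∧-congˡ (sym (∨-complementʳ y))) (∧-distribˡ-∨ x y (∼ y)))

  ∧-closed : ∀ {i x y} → Closed i x → Closed i y → Closed i (x ∧ y)
  ∧-closed {x = x} cx cy = trans (cyl-∧-closed x cy) (∧-congʳ cx)

  diag-⊤ : ∀ {i j} → i ≡ j → diag i j ≋ ⊤
  diag-⊤ ≡.refl = diag-refl _

  diag-symm : ∀ i j → diag i j ≋ diag j i
  diag-symm i j with i ≟ j
  ... | yes ≡.refl = refl
  ... | no i≢j     = diag-sym i≢j

  diag-⊑-trans : ∀ i j k → diag i j ∧ diag j k ⊑ diag i k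
  diag-⊑-trans i j k with i ≟ j
  ... | yes ≡.refl = x∧y≤y _ _
  ... | no i≢j with j ≟ k
  ...   | yes ≡.refl = x∧y≤x _ _
  ...   | no j≢k with i ≟ k
  ...     | yes ≡.refl = ⊑-trans (⊤-max _) (⊑-reflexive (sym (diag-refl i)))
  ...     | no i≢k     = ⊑-trans (cyl-incr-⊑ j _) (⊑-reflexive (diag-trans i≢j j≢k i≢k))

  diag-closed : ∀ {i j k} → k ≢ i → k ≢ j → Closed k (diag i j)
  diag-closed {i} {j} {k} k≢i k≢j with i ≟ j
  ... | yes ≡.refl = Closed-resp (sym (diag-refl i)) ⊤-closed
  ... | no i≢j     = Closed-resp (diag-trans (k≢i ∘ ≡.sym) k≢j i≢j) (cyl-closed k _)

  -- The substitution operator of cylindric algebras: a sequence s belongs to it iff s with its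
  -- value at i changed to the value at p belongs to x. For i = p it degenerates to `cyl i`, whence
  -- the hypotheses `i ≢ p` below.
  sub : I → I → Op₁ Carrier
  sub i p x = cyl i (diag i p ∧ x)

  sub-cong : ∀ i p → Congruent₁ _≋_ (sub i p)
  sub-cong i p x≋y = cyl-cong i (∧-congˡ x≋y)

  sub-∨ : ∀ i p x y → sub i p (x ∨ y) ≋ sub i p x ∨ sub i p y
  sub-∨ i p x y = trans (cyl-cong i (∧-distribˡ-∨ _ x y)) (cyl-∨ i _ _)

  diag-∧-⊑-sub : ∀ i p x → diag i p ∧ x ⊑ sub i p x
  diag-∧-⊑-sub i p x = cyl-incr-⊑ i _

  sub-closed : ∀ {i p} → i ≢ p → ∀ {x} → Closed i x → sub i p x ≋ x
  sub-closed {i} {p} i≢p {x} cx = begin-equality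
    cyl i (diag i p ∧ x)  ≈⟨ cyl-∧-closed _ cx ⟩
    cyl i (diag i p) ∧ x  ≈⟨ ∧-congʳ (cyl-diag i≢p) ⟩
    ⊤ ∧ x                 ≈⟨ ∧-identityˡ x ⟩
    x                     ∎

  -- Complements are unique. The join is the substitution in ⊤, which is closed. In the meet,
  -- `diag-cyl` reduces `sub i p (∼ x)` on the diagonal to `∼ x`, which contradicts x.
  sub-∼ : ∀ {i p} → i ≢ p → ∀ x → sub i p (∼ x) ≋ ∼ sub i p x
  sub-∼ {i} {p} i≢p x = ∼-unique
    (begin-equality
      sub i p x ∨ sub i p (∼ x)  ≈⟨ sub-∨ i p x (∼ x) ⟨
      sub i p (x ∨ ∼ x)          ≈⟨ sub-cong i p (∨-complementʳ x) ⟩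
      sub i p ⊤                  ≈⟨ sub-closed i≢p ⊤-closed ⟩
      ⊤                          ∎)
    (begin-equality
      sub i p x ∧ sub i p (∼ x)                  ≈⟨ cyl-∧-closed _ (cyl-closed i _) ⟨
      cyl i ((diag i p ∧ x) ∧ sub i p (∼ x))     ≈⟨ cyl-cong i (trans (∧-congʳ (∧-comm _ x)) (∧-assoc x _ _)) ⟩
      cyl i (x ∧ (diag i p ∧ sub i p (∼ x)))     ≈⟨ cyl-cong i (∧-congˡ (diag-cyl i≢p (∼ x))) ⟩
      cyl i (x ∧ (diag i p ∧ ∼ x))               ≈⟨ cyl-cong i (∧-congˡ (∧-comm _ (∼ x))) ⟩
      cyl i (x ∧ (∼ x ∧ diag i p))               ≈⟨ cyl-cong i (∧-assoc x _ _) ⟨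
      cyl i ((x ∧ ∼ x) ∧ diag i p)               ≈⟨ cyl-cong i (trans (∧-congʳ (∧-complementʳ x)) (∧-zeroˡ _)) ⟩
      cyl i ⊥                                    ≈⟨ ⊥-closed ⟩
      ⊥                                          ∎)

  sub-cyl-comm : ∀ {i j p} → j ≢ i → j ≢ p → ∀ x → sub i p (cyl j x) ≋ cyl j (sub i p x)
  sub-cyl-comm {i} {j} {p} j≢i j≢p x = begin-equality
    cyl i (diag i p ∧ cyl j x)    ≈⟨ cyl-cong i (trans (∧-comm _ _) (sym (cyl-∧-closed x (diag-closed j≢i j≢p)))) ⟩
    cyl i (cyl j (x ∧ diag i p))  ≈⟨ cyl-commute i j _ ⟩
    cyl j (cyl i (x ∧ diag i p))  ≈⟨ cyl-cong j (cyl-cong i (∧-comm _ _)) ⟩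
    cyl j (sub i p x)             ∎

  sub-comm : ∀ {i j p q} → i ≢ j → i ≢ q → j ≢ p → ∀ x → sub i p (sub j q x) ≋ sub j q (sub i p x)
  sub-comm {i} {j} {p} {q} i≢j i≢q j≢p x = begin-equality
    sub i p (cyl j (diag j q ∧ x))               ≈⟨ sub-cyl-comm (i≢j ∘ ≡.sym) j≢p _ ⟩
    cyl j (cyl i (diag i p ∧ (diag j q ∧ x)))    ≈⟨ cyl-cong j (cyl-cong i (swap-∧ _ _ _)) ⟩
    cyl j (cyl i ((diag i p ∧ x) ∧ diag j q))    ≈⟨ cyl-cong j (cyl-∧-closed _ (diag-closed i≢j i≢q)) ⟩
    cyl j (sub i p x ∧ diag j q)                 ≈⟨ cyl-cong j (∧-comm _ _) ⟩
    sub j q (sub i p x)                          ∎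
    where
    swap-∧ : ∀ u v w → u ∧ (v ∧ w) ≋ (u ∧ w) ∧ v
    swap-∧ u v w = trans (∧-congˡ (∧-comm v w)) (sym (∧-assoc u w v))

  -- Renaming of a bound variable: p may replace i under the quantifier when x does not depend on p.
  -- Once the two cylindrifications are exchanged, `cyl p` acts on the diagonal only and turns it
  -- into ⊤.
  cyl-sub : ∀ {i p} → i ≢ p → ∀ {x} → Closed p x → cyl p (sub i p x) ≋ cyl i x
  cyl-sub {i} {p} i≢p {x} cx = begin-equality
    cyl p (cyl i (diag i p ∧ x))  ≈⟨ cyl-commute p i _ ⟩
    cyl i (cyl p (diag i p ∧ x))  ≈⟨ cyl-cong i (cyl-∧-closed _ cx) ⟩
    cyl i (cyl p (diag i p) ∧ x)  ≈⟨ cyl-cong i (∧-congʳ (trans (cyl-cong p (diag-symm i p)) (cyl-diag (i≢p ∘ ≡.sym)))) ⟩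
    cyl i (⊤ ∧ x)                 ≈⟨ cyl-cong i (∧-identityˡ x) ⟩
    cyl i x                       ∎

  sub-⊑-cyl : ∀ i p x → sub i p x ⊑ cyl i x
  sub-⊑-cyl i p x = cyl-mono i (x∧y≤y _ _)

  -- The replacement law for equality. In the Henkin model it exchanges a witness for the
  -- representative of its class.
  sub-diag-⊑ : ∀ {i p q} → i ≢ p → i ≢ q → ∀ x → sub i p x ∧ diag p q ⊑ sub i q x
  sub-diag-⊑ {i} {p} {q} i≢p i≢q x = begin
    sub i p x ∧ diag p q                ≈⟨ cyl-∧-closed _ (diag-closed i≢p i≢q) ⟨
    cyl i ((diag i p ∧ x) ∧ diag p q)   ≤⟨ cyl-mono i (∧-greatest
      (⊑-trans (∧-mono (x∧y≤x _ _) ⊑-refl) (diag-⊑-trans i p q))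
      (⊑-trans (x∧y≤x _ _) (x∧y≤y _ _))) ⟩
    sub i q x                           ∎

  sub-diagˡ : ∀ {i p j} → i ≢ p → i ≢ j → sub i p (diag i j) ≋ diag p j
  sub-diagˡ {i} {p} {j} i≢p i≢j with p ≟ j
  ... | yes ≡.refl = trans (cyl-cong i (∧-idem _)) (trans (cyl-diag i≢p) (sym (diag-refl p)))
  ... | no p≢j     = trans (cyl-cong i (∧-congʳ (diag-symm i p)))
                       (diag-trans (i≢p ∘ ≡.sym) i≢j p≢j)

  rename : I → I → I → I
  rename i p j with j ≟ i
  ... | yes _ = p
  ... | no _  = j

  rename-same : ∀ i p → rename i p i ≡ p
  rename-same i p with i ≟ i
  ... | yes _  = ≡.refl
  ... | no i≢i = contradiction ≡.refl i≢i

  rename-other : ∀ {i p j} → j ≢ i → rename i p j ≡ j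
  rename-other {i} {p} {j} j≢i with j ≟ i
  ... | yes j≡i = contradiction j≡i j≢i
  ... | no _    = ≡.refl

  sub-diag : ∀ {i p} → i ≢ p → ∀ j k → sub i p (diag j k) ≋ diag (rename i p j) (rename i p k)
  sub-diag {i} {p} i≢p j k with j ≟ i | k ≟ i
  ... | yes ≡.refl | yes ≡.refl = trans (sub-cong i p (diag-refl i))
                                    (trans (sub-closed i≢p ⊤-closed) (sym (diag-refl p)))
  ... | yes ≡.refl | no k≢i     = sub-diagˡ i≢p (k≢i ∘ ≡.sym)
  ... | no j≢i     | yes ≡.refl = trans (sub-cong i p (diag-symm j i))
                                    (trans (sub-diagˡ i≢p (j≢i ∘ ≡.sym)) (diag-symm p j))
  ... | no j≢i     | no k≢i     = sub-closed i≢p (diag-closed (j≢i ∘ ≡.sym) (k≢i ∘ ≡.sym))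

-- Simultaneous substitution of constants.

-- subs m τ substitutes τ j for every j < m at once, provided that the values
-- of τ lie above m; k separates the indices to be replaced from the values.

module Substitution {b ℓ : Level} (𝔄 : CylindricAlgebra ℕ b ℓ) (k : ℕ) where
  open CylindricAlgebra 𝔄

  subs : ℕ → (ℕ → ℕ) → Op₁ Carrier
  subs zero    τ x = x
  subs (suc m) τ x = subs m τ (sub m (τ m) x)

  Above : (ℕ → ℕ) → Set
  Above τ = ∀ n → k ℕ.≤ τ n

  subs-cong : ∀ m τ {x y} → x ≋ y → subs m τ x ≋ subs m τ y
  subs-cong zero    τ x≋y = x≋y
  subs-cong (suc m) τ x≋y = subs-cong m τ (sub-cong m (τ m) x≋y)

  subs-∨ : ∀ m τ x y → subs m τ (x ∨ y) ≋ subs m τ x ∨ subs m τ y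
  subs-∨ zero    τ x y = refl
  subs-∨ (suc m) τ x y = trans (subs-cong m τ (sub-∨ m (τ m) x y)) (subs-∨ m τ _ _)

  module _ {τ : ℕ → ℕ} (above : Above τ) where

    below≢ : ∀ {m n} → m ℕ.< k → m ≢ τ n
    below≢ m<k m≡τn = ℕ.<⇒≢ (ℕ.<-≤-trans m<k (above _)) m≡τn

    subs-∼ : ∀ {m} → m ℕ.≤ k → ∀ x → subs m τ (∼ x) ≋ ∼ subs m τ x
    subs-∼ {zero}  m≤k x = refl
    subs-∼ {suc m} m<k x =
      trans (subs-cong m τ (sub-∼ (below≢ m<k) x)) (subs-∼ (ℕ.<⇒≤ m<k) _)

    subs-sub : ∀ {m i p} → m ℕ.≤ i → i ℕ.< k → k ℕ.≤ p → ∀ x →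
               subs m τ (sub i p x) ≋ sub i p (subs m τ x)
    subs-sub {zero}  m≤i i<k k≤p x = refl
    subs-sub {suc m} {i} m<i i<k k≤p x = trans
      (subs-cong m τ (sub-comm (ℕ.<⇒≢ m<i) (ℕ.<⇒≢ (ℕ.<-trans m<i (ℕ.<-≤-trans i<k k≤p))) (below≢ i<k) x))
      (subs-sub (ℕ.<⇒≤ m<i) i<k k≤p _)

    subs-cyl-≥ : ∀ {m i} → m ℕ.≤ i → i ℕ.< k → ∀ x → subs m τ (cyl i x) ≋ cyl i (subs m τ x)
    subs-cyl-≥ {zero}  m≤i i<k x = refl
    subs-cyl-≥ {suc m} m<i i<k x = trans
      (subs-cong m τ (sub-cyl-comm (ℕ.<⇒≢ m<i ∘ ≡.sym) (below≢ i<k) x))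
      (subs-cyl-≥ (ℕ.<⇒≤ m<i) i<k _)

    -- Since `subs` replaces the highest index first, this follows a single index n through the
    -- replacements of m - 1, ..., 0 in that order.
    inst : ℕ → ℕ → ℕ
    inst zero    n = n
    inst (suc m) n = inst m (rename m (τ m) n)

    inst-≥ : ∀ m {n} → m ℕ.≤ n → inst m n ≡ n
    inst-≥ zero    m≤n = ≡.refl
    inst-≥ (suc m) m<n rewrite rename-other {m} {τ m} (ℕ.<⇒≢ m<n ∘ ≡.sym) = inst-≥ m (ℕ.<⇒≤ m<n)

    inst-< : ∀ {m n} → m ℕ.≤ k → n ℕ.< m → inst m n ≡ τ n
    inst-< {suc m} {n} m<k n<1+m with n ℕ.≟ m
    -- The value `τ m` is at least k, so the later replacements of indices below m leave it alone.
    ... | yes ≡.refl rewrite rename-same m (τ m) = inst-≥ m (ℕ.≤-trans (ℕ.<⇒≤ m<k) (above m))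
    ... | no n≢m rewrite rename-other {m} {τ m} n≢m =
      inst-< (ℕ.<⇒≤ m<k) (ℕ.≤∧≢⇒< (ℕ.s≤s⁻¹ n<1+m) n≢m)

    subs-diag : ∀ {m} → m ℕ.≤ k → ∀ i j → subs m τ (diag i j) ≋ diag (inst m i) (inst m j)
    subs-diag {zero}  m≤k i j = refl
    subs-diag {suc m} m<k i j =
      trans (subs-cong m τ (sub-diag (below≢ m<k) i j)) (subs-diag (ℕ.<⇒≤ m<k) _ _)

    subs-diag-< : ∀ {i j} → i ℕ.< k → j ℕ.< k → subs k τ (diag i j) ≋ diag (τ i) (τ j)
    subs-diag-< {i} {j} i<k j<k =
      ≡.subst₂ (λ p q → subs k τ (diag i j) ≋ diag p q)
        (inst-< ℕ.≤-refl i<k) (inst-< ℕ.≤-refl j<k) (subs-diag ℕ.≤-refl i j)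

  subs-ext : ∀ m {τ τ′} → (∀ {n} → n ℕ.< m → τ n ≡ τ′ n) → ∀ x → subs m τ x ≡ subs m τ′ x
  subs-ext zero    eq x = ≡.refl
  subs-ext (suc m) eq x rewrite eq (ℕ.n<1+n m) = subs-ext m (eq ∘ ℕ.m<n⇒m<1+n) _

  -- ψ is x with every index below m except i replaced.

  subs-cyl : ∀ {m i τ} → m ℕ.≤ k → i ℕ.< m → Above τ → ∀ x → ∃[ ψ ]
    subs m τ (cyl i x) ≋ cyl i ψ ×
    (∀ {τ′} → Above τ′ → (∀ {j} → j ≢ i → τ j ≡ τ′ j) → subs m τ′ x ≋ sub i (τ′ i) ψ)
  subs-cyl {suc m} {i} {τ} m<k i<1+m above x with i ℕ.≟ m
  -- Replacing m = i does nothing to `cyl m x`. In x itself it may be done last instead of first, by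
  -- `subs-sub`, so the element before that replacement can serve as ψ.
  ... | yes ≡.refl = subs m τ x
    , trans (subs-cong m τ (sub-closed (below≢ above m<k) (cyl-closed m x)))
        (subs-cyl-≥ above ℕ.≤-refl m<k x)
    , λ {τ′} above′ eq → trans
        (reflexive (≡.sym (subs-ext m (λ n<m → eq (ℕ.<⇒≢ n<m)) (sub m (τ′ m) x))))
        (subs-sub above ℕ.≤-refl m<k (above′ m) x)
  ... | no i≢m with subs-cyl (ℕ.<⇒≤ m<k) (ℕ.≤∧≢⇒< (ℕ.s≤s⁻¹ i<1+m) i≢m) above (sub m (τ m) x)
  ...   | ψ , eq₁ , eq₂ = ψ
    , trans (subs-cong m τ (sub-cyl-comm i≢m (below≢ above (ℕ.<-≤-trans i<1+m m<k)) x)) eq₁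
    , λ {τ′} above′ eq → trans
        (reflexive (≡.cong (λ p → subs m τ′ (sub m p x)) (≡.sym (eq (i≢m ∘ ≡.sym)))))
        (eq₂ above′ eq)

-- Henkin ultrafilters in countable locally finite algebras.

-- Pairs are enumerated because each stage of the ultrafilter construction treats one element
-- `cyl i x` together with a witness for it.
record IsCountableLocallyFinite {b ℓ : Level} (𝔄 : CylindricAlgebra ℕ b ℓ) : Set (b ⊔ₗ ℓ) where
  open CylindricAlgebra 𝔄
  field
    enum            : ℕ → ℕ × Carrier
    enum-surjective : ∀ i x → ∃[ n ] enum n ≡ (i , x)
    bound           : Carrier → ℕ
    bound-closed    : ∀ x {p} → bound x ℕ.≤ p → Closed p x

record HenkinUltrafilter {b ℓ : Level} (𝔄 : CylindricAlgebra ℕ b ℓ) (k : ℕ) : Set (b ⊔ₗ lsuc ℓ) where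
  open CylindricAlgebra 𝔄
  field
    filter    : Pred Carrier ℓ
    upward    : ∀ {x y} → x ⊑ y → filter x → filter y
    meet      : ∀ {x y} → filter x → filter y → filter (x ∧ y)
    proper    : ¬ filter ⊥
    maximal   : ∀ x → filter x ⊎ filter (∼ x)
    witnessed : ∀ {i x} → filter (cyl i x) → ∃[ p ] k ℕ.≤ p × i ≢ p × filter (sub i p x)

  resp : ∀ {x y} → x ≋ y → filter x → filter y
  resp x≋y = upward (⊑-reflexive x≋y)

  ⊤-filter : filter ⊤
  ⊤-filter = [ upward (⊤-max _) , (λ p → upward (⊤-max _) p) ]′ (maximal ⊤)

  ∼⇒¬ : ∀ {x} → filter (∼ x) → ¬ filter x
  ∼⇒¬ p q = proper (resp (∧-complementʳ _) (meet q p))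

  ¬⇒∼ : ∀ {x} → ¬ filter x → filter (∼ x)
  ¬⇒∼ {x} ¬p = [ (λ p → contradiction p ¬p) , (λ q → q) ]′ (maximal x)

  prime : ∀ {x y} → filter (x ∨ y) → filter x ⊎ filter y
  prime {x} {y} p with maximal x
  ... | inj₁ q = inj₁ q
  ... | inj₂ q = inj₂ (upward x∨y∧∼x⊑y (meet p q))
    where
    x∨y∧∼x⊑y : (x ∨ y) ∧ ∼ x ⊑ y
    x∨y∧∼x⊑y = ⊑-trans (⊑-reflexive (trans (∧-distribʳ-∨ (∼ x) x y)
      (trans (∨-congʳ (∧-complementʳ x)) (∨-identityˡ _)))) (x∧y≤x _ _)

module _ {b ℓ : Level} (em : ExcludedMiddle ℓ) {𝔄 : CylindricAlgebra ℕ b ℓ}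
         (finite : IsCountableLocallyFinite 𝔄) (k : ℕ) where
  open CylindricAlgebra 𝔄
  open IsCountableLocallyFinite finite

  private
    -- The witness is an index fresh for everything in sight, so that adding
    -- sub i p x below cyl i x keeps an element nonzero (cyl-sub).
    fresh : Carrier → ℕ → Carrier → ℕ
    fresh y i x = k ⊔ (suc i ⊔ (bound y ⊔ bound x))

    -- An element y disjoint from `cyl i x` is already below its complement, so the question is
    -- settled without a change. Otherwise `cyl i x` is settled positively and a witness is added.
    step : Carrier → ℕ × Carrier → Carrier
    step y (i , x) with em {y ∧ cyl i x ≋ ⊥}
    ... | yes _ = y
    ... | no _  = (y ∧ cyl i x) ∧ sub i (fresh y i x) x

    step-⊑ : ∀ y q → step y q ⊑ y
    step-⊑ y (i , x) with em {y ∧ cyl i x ≋ ⊥}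
    ... | yes _ = ⊑-refl
    ... | no _  = ⊑-trans (x∧y≤x _ _) (x∧y≤x _ _)

    k≤fresh : ∀ y i x → k ℕ.≤ fresh y i x
    k≤fresh y i x = ℕ.m≤m⊔n k _

    i<fresh : ∀ y i x → i ℕ.< fresh y i x
    i<fresh y i x = ℕ.≤-trans (ℕ.m≤m⊔n (suc i) (bound y ⊔ bound x)) (ℕ.m≤n⊔m k _)

    fresh-closed : ∀ y i x → Closed (fresh y i x) y × Closed (fresh y i x) x
    fresh-closed y i x =
        bound-closed y (ℕ.≤-trans (ℕ.m≤m⊔n (bound y) _) bounds≤)
      , bound-closed x (ℕ.≤-trans (ℕ.m≤n⊔m (bound y) _) bounds≤)
      where
      bounds≤ : bound y ⊔ bound x ℕ.≤ fresh y i x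
      bounds≤ = ℕ.≤-trans (ℕ.m≤n⊔m (suc i) _) (ℕ.m≤n⊔m k _)

    -- In the second case, applying `cyl p` to the new element gives back `y ∧ cyl i x`: `cyl-sub`
    -- turns the witness into `cyl i x`, and neither y nor x depends on the fresh p. So the new
    -- element is zero only if `y ∧ cyl i x` is.
    step-≭⊥ : ∀ {y} q → y ≭ ⊥ → step y q ≭ ⊥
    step-≭⊥ {y} (i , x) y≭⊥ with em {y ∧ cyl i x ≋ ⊥}
    ... | yes _      = y≭⊥
    ... | no y∧cx≭⊥ = λ eq → y∧cx≭⊥ (begin
      y ∧ cyl i x                          ≈⟨ ∧-congˡ (∧-idem _) ⟨
      y ∧ (cyl i x ∧ cyl i x)              ≈⟨ ∧-assoc _ _ _ ⟨
      (y ∧ cyl i x) ∧ cyl i x              ≈⟨ ∧-congˡ (cyl-sub i≢p x-closed) ⟨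
      (y ∧ cyl i x) ∧ cyl p (sub i p x)    ≈⟨ ∧-comm _ _ ⟩
      cyl p (sub i p x) ∧ (y ∧ cyl i x)    ≈⟨ cyl-∧-closed _ (∧-closed y-closed (cyl-preserves-closed i x-closed)) ⟨
      cyl p (sub i p x ∧ (y ∧ cyl i x))    ≈⟨ cyl-cong p (trans (∧-comm _ _) eq) ⟩
      cyl p ⊥                              ≈⟨ ⊥-closed ⟩
      ⊥                                    ∎)
      where
      open SetoidReasoning setoid
      p : ℕ
      p = fresh y i x
      i≢p : i ≢ p
      i≢p = ℕ.<⇒≢ (i<fresh y i x)
      y-closed : Closed p y
      y-closed = proj₁ (fresh-closed y i x)
      x-closed : Closed p x
      x-closed = proj₂ (fresh-closed y i x)

    stage : Carrier → ℕ → Carrier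
    stage a zero    = a
    stage a (suc n) = step (stage a n) (enum n)

    stage-antitone : ∀ a {m n} → m ℕ.≤′ n → stage a n ⊑ stage a m
    stage-antitone a ℕ.≤′-refl       = ⊑-refl
    stage-antitone a (ℕ.≤′-step m≤n) = ⊑-trans (step-⊑ _ (enum _)) (stage-antitone a m≤n)

    stage-≭⊥ : ∀ {a} → a ≭ ⊥ → ∀ n → stage a n ≭ ⊥
    stage-≭⊥ a≭⊥ zero    = a≭⊥
    stage-≭⊥ a≭⊥ (suc n) = step-≭⊥ (enum n) (stage-≭⊥ a≭⊥ n)

    decide : ∀ y i x → step y (i , x) ⊑ ∼ cyl i x ⊎
      (step y (i , x) ⊑ cyl i x × step y (i , x) ⊑ sub i (fresh y i x) x)
    decide y i x with em {y ∧ cyl i x ≋ ⊥}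
    ... | yes eq = inj₁ (∧-⊥⇒⊑∼ eq)
    ... | no _   = inj₂ (⊑-trans (x∧y≤x _ _) (x∧y≤y _ _) , x∧y≤y _ _)

    stage-decides : ∀ a i x → ∃[ n ] (stage a n ⊑ ∼ cyl i x ⊎
      (stage a n ⊑ cyl i x × ∃[ p ] k ℕ.≤ p × i ≢ p × stage a n ⊑ sub i p x))
    stage-decides a i x with enum-surjective i x
    ... | n , eq = suc n , ≡.subst (λ q → step y q ⊑ ∼ cyl i x ⊎
          (step y q ⊑ cyl i x × ∃[ p ] k ℕ.≤ p × i ≢ p × step y q ⊑ sub i p x)) (≡.sym eq)
        ([ inj₁ , (λ (p , q) → inj₂ (p , fresh y i x , k≤fresh y i x , ℕ.<⇒≢ (i<fresh y i x) , q)) ]′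
          (decide y i x))
      where
      y : Carrier
      y = stage a n

  henkin : ∀ {a} → a ≭ ⊥ → Σ[ U ∈ HenkinUltrafilter 𝔄 k ] HenkinUltrafilter.filter U a
  henkin {a} a≭⊥ = record
    { filter    = F
    ; upward    = λ x⊑y (n , p) → n , ⊑-trans p x⊑y
    ; meet      = λ (m , p) (n , q) → m ⊔ n , ∧-greatest
        (⊑-trans (stage-antitone a (ℕ.≤⇒≤′ (ℕ.m≤m⊔n m n))) p)
        (⊑-trans (stage-antitone a (ℕ.≤⇒≤′ (ℕ.m≤n⊔m m n))) q)
    ; proper    = proper
    ; maximal   = maximal
    ; witnessed = witnessed
    } , 0 , ⊑-refl
    where
    F : Pred Carrier ℓ
    F x = ∃[ n ] stage a n ⊑ x

    proper : ¬ F ⊥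
    proper (n , p) = stage-≭⊥ a≭⊥ n (⊑⊥⇒≋⊥ p)

    maximal : ∀ x → F x ⊎ F (∼ x)
    -- By local finiteness x equals its cylindrification along `bound x`, so the stages, which
    -- decide cylindrifications, decide every element.
    maximal x with stage-decides a (bound x) x
    ... | n , inj₁ p       = inj₂ (n , ⊑-trans p (⊑-reflexive (∼-cong (bound-closed x ℕ.≤-refl))))
    ... | n , inj₂ (p , _) = inj₁ (n , ⊑-trans p (⊑-reflexive (bound-closed x ℕ.≤-refl)))

    witnessed : ∀ {i x} → F (cyl i x) → ∃[ p ] k ℕ.≤ p × i ≢ p × F (sub i p x)
    witnessed {i} {x} (m , q) with stage-decides a i x
    ... | n , inj₂ (_ , p , k≤p , i≢p , s) = p , k≤p , i≢p , n , s
    ... | n , inj₁ s = contradiction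
      (m ⊔ n , ⊑-trans (∧-greatest
        (⊑-trans (stage-antitone a (ℕ.≤⇒≤′ (ℕ.m≤m⊔n m n))) q)
        (⊑-trans (stage-antitone a (ℕ.≤⇒≤′ (ℕ.m≤n⊔m m n))) s))
        (⊑-reflexive (∧-complementʳ _)))
      proper

-- Enumeration of the terms over ω.

ω : Ordinal 0ℓ
ω = record
  { Index              = ℕ
  ; _<_                = ℕ._<_
  ; isStrictTotalOrder = ℕ.<-isStrictTotalOrder
  ; wellFounded        = <-wellFounded
  }

-- A walk through the antidiagonals a + b = 0, 1, 2, ..., each from (a + b , 0) to (0 , a + b).
unpair : ℕ → ℕ × ℕ
unpair zero    = 0 , 0
unpair (suc n) with unpair n
... | zero  , b = suc b , 0
... | suc a , b = a , suc b

unpair-surjective : ∀ a b → ∃[ n ] unpair n ≡ (a , b)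
unpair-surjective a b = go (a ℕ.+ b) a b ≡.refl
  where
  next : ∀ n {a b} → unpair n ≡ (suc a , b) → unpair (suc n) ≡ (a , suc b)
  next n eq rewrite eq = ≡.refl

  next₀ : ∀ n {b} → unpair n ≡ (0 , b) → unpair (suc n) ≡ (suc b , 0)
  next₀ n eq rewrite eq = ≡.refl

  go : ∀ s a b → a ℕ.+ b ≡ s → ∃[ n ] unpair n ≡ (a , b)
  go s       zero    zero    eq = 0 , ≡.refl
  -- The pair opens its antidiagonal, so it comes right after (0 , a), the end of the one before.
  go (suc s) (suc a) zero    eq with go s 0 a (≡.trans (≡.sym (ℕ.+-identityʳ a)) (ℕ.suc-injective eq))
  ... | n , p = suc n , next₀ n p
  go s       a       (suc b) eq with go s (suc a) b (≡.trans (≡.sym (ℕ.+-suc a b)) eq)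
  ... | n , p = suc n , next n p

module _ (f : ℕ → Term ω) where

  node : ℕ × ℕ → Term ω
  node (0 , r) = var r
  node (1 , r) = f (proj₁ (unpair r)) + f (proj₂ (unpair r))
  node (2 , r) = - f r
  node (3 , r) = c (proj₁ (unpair r)) (f (proj₂ (unpair r)))
  node (_ , r) = d (proj₁ (unpair r)) (proj₂ (unpair r))

-- The codes of subterms are not structurally smaller, so the depth of decoding is limited by
-- `fuel`, which `enumTerm` enumerates along with the code.
decode : ℕ → ℕ → Term ω
decode zero       m = var m
decode (suc fuel) m = node (decode fuel) (unpair m)

height : Term ω → ℕ
height (var n) = 0
height (s + t) = suc (height s ⊔ height t)
height (- t)   = suc (height t)
height (c i t) = suc (height t)
-- Without fuel only variables are decoded, so a diagonal constant takes one unit.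
height (d i j) = 1

decode-surjective : ∀ {fuel} t → height t ℕ.≤ fuel → ∃[ m ] decode fuel m ≡ t
decode-surjective {zero}     (var n) h = n , ≡.refl
decode-surjective {suc fuel} (var n) h with unpair-surjective 0 n
... | m , eq = m , ≡.cong (node (decode fuel)) eq
decode-surjective {suc fuel} (s + t) h
  with decode-surjective {fuel} s (ℕ.≤-trans (ℕ.m≤m⊔n _ _) (ℕ.s≤s⁻¹ h))
     | decode-surjective {fuel} t (ℕ.≤-trans (ℕ.m≤n⊔m _ _) (ℕ.s≤s⁻¹ h))
... | a , ≡.refl | b , ≡.refl with unpair-surjective a b
...   | r , eqʳ with unpair-surjective 1 r
...     | m , eq = m , ≡.trans (≡.cong (node (decode fuel)) eq)
                     (≡.cong (λ p → decode fuel (proj₁ p) + decode fuel (proj₂ p)) eqʳ)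
decode-surjective {suc fuel} (- t) h with decode-surjective {fuel} t (ℕ.s≤s⁻¹ h)
... | a , ≡.refl with unpair-surjective 2 a
...   | m , eq = m , ≡.cong (node (decode fuel)) eq
decode-surjective {suc fuel} (c i t) h with decode-surjective {fuel} t (ℕ.s≤s⁻¹ h)
... | a , ≡.refl with unpair-surjective i a
...   | r , eqʳ with unpair-surjective 3 r
...     | m , eq = m , ≡.trans (≡.cong (node (decode fuel)) eq)
                     (≡.cong (λ p → c (proj₁ p) (decode fuel (proj₂ p))) eqʳ)
decode-surjective {suc fuel} (d i j) h with unpair-surjective i j
... | r , eqʳ with unpair-surjective 4 r
...   | m , eq = m , ≡.trans (≡.cong (node (decode fuel)) eq)
                   (≡.cong (λ p → d (proj₁ p) (proj₂ p)) eqʳ)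

enumTerm : ℕ → ℕ × Term ω
enumTerm n = proj₁ (unpair n) , decode (proj₁ (unpair (proj₂ (unpair n)))) (proj₂ (unpair (proj₂ (unpair n))))

enumTerm-surjective : ∀ i t → ∃[ n ] enumTerm n ≡ (i , t)
enumTerm-surjective i t with decode-surjective t ℕ.≤-refl
... | m , eqᵗ with unpair-surjective (height t) m
...   | r , eqʳ with unpair-surjective i r
...     | n , eq = n , ≡.trans
  (≡.cong (λ (a , b) → a , decode (proj₁ (unpair b)) (proj₂ (unpair b))) eq)
  (≡.cong (i ,_) (≡.trans (≡.cong (λ (a , b) → decode a b) eqʳ) eqᵗ))

-- Variables count as 0 because in `LF` they are closed under every index from k on; that threshold
-- is added separately in `bound-closed`.
bound : Term ω → ℕ
bound (var n) = 0
bound (s + t) = bound s ⊔ bound t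
bound (- t)   = bound t
bound (c i t) = suc i ⊔ bound t
bound (d i j) = suc i ⊔ suc j

-- Indices of terms, and injections of an infinite ordinal into itself.

module _ {ℓ : Level} {α : Ordinal ℓ} where

  indices : Term α → List (Index α)
  indices (var n) = []
  indices (s + t) = indices s ++ indices t
  indices (- t)   = indices t
  indices (c i t) = i ∷ indices t
  indices (d i j) = i ∷ j ∷ []

  occursIn⇒∈indices : ∀ {i} {t : Term α} → i occursIn t → i ∈ₗ indices t
  occursIn⇒∈indices (in-+ˡ p)          = ∈-++⁺ˡ (occursIn⇒∈indices p)
  occursIn⇒∈indices (in-+ʳ {s = s} p)  = ∈-++⁺ʳ (indices s) (occursIn⇒∈indices p)
  occursIn⇒∈indices (in-- p)           = occursIn⇒∈indices p
  occursIn⇒∈indices at-c               = here ≡.refl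
  occursIn⇒∈indices (in-c p)           = there (occursIn⇒∈indices p)
  occursIn⇒∈indices at-dˡ              = here ≡.refl
  occursIn⇒∈indices at-dʳ              = there (here ≡.refl)

  ∈indices⇒occursIn : ∀ {i} (t : Term α) → i ∈ₗ indices t → i occursIn t
  ∈indices⇒occursIn (s + t) p with ∈-++⁻ (indices s) p
  ... | inj₁ q = in-+ˡ (∈indices⇒occursIn s q)
  ... | inj₂ q = in-+ʳ (∈indices⇒occursIn t q)
  ∈indices⇒occursIn (- t)   p                     = in-- (∈indices⇒occursIn t p)
  ∈indices⇒occursIn (c j t) (here ≡.refl)         = at-c
  ∈indices⇒occursIn (c j t) (there p)             = in-c (∈indices⇒occursIn t p)
  ∈indices⇒occursIn (d j k) (here ≡.refl)         = at-dˡ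
  ∈indices⇒occursIn (d j k) (there (here ≡.refl)) = at-dʳ

unique-index : ∀ {a} {A : Set a} {xs : List A} → Unique xs →
               ∀ k (p : lookup xs k ∈ₗ xs) → Any.index p ≡ k
unique-index (x∉ ∷ u) zero    (here _)  = ≡.refl
unique-index (x∉ ∷ u) zero    (there p) = contradiction ≡.refl (All.lookup x∉ p)
unique-index (x∉ ∷ u) (suc k) (here eq) = contradiction (≡.sym eq) (All.lookup x∉ (∈-lookup k))
unique-index (x∉ ∷ u) (suc k) (there p) = ≡.cong suc (unique-index u k p)

module _ {ℓ : Level} (em : ExcludedMiddle ℓ) (α : Ordinal ℓ) (infinite : Infinite α) where

  open Ordinal α using (_≟_)

  -- If L contained every index, the position in L without repetitions would be a bijection of α
  -- with a finite set.
  fresh-index : (L : List (Index α)) → ∃[ i ] i ∉ₗ L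
  fresh-index L with em {∃[ i ] i ∉ₗ L}
  ... | yes p = p
  ... | no ¬p = contradiction (length L′ , mk↔ₛ′ (Any.index ∘ covers) (lookup L′)
                  (λ k → unique-index (deduplicate-! _≟_ L) k (covers (lookup L′ k)))
                  (λ i → ≡.sym (lookup-index (covers i))))
                infinite
    where
    L′ : List (Index α)
    L′ = deduplicate _≟_ L

    covers : ∀ i → i ∈ₗ L′
    covers i = ∈-deduplicate⁺ _≟_ (decidable-stable em (λ i∉L → ¬p (i , i∉L)))

  private
    pick : List (Index α) → Index α → Index α
    pick L i with em {i ∈ₗ L}
    ... | yes _ = proj₁ (fresh-index L)
    ... | no _  = i

    pick-∉ : ∀ L i → pick L i ∉ₗ L
    pick-∉ L i with em {i ∈ₗ L}
    ... | yes _  = proj₂ (fresh-index L)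
    ... | no i∉L = i∉L

    pick-covers : ∀ L i → i ∈ₗ pick L i ∷ L
    pick-covers L i with em {i ∈ₗ L}
    ... | yes i∈L = there i∈L
    ... | no _    = here ≡.refl

  infinite-sequence : (L : List (Index α)) (γ : ℕ → Index α) → Σ[ g ∈ (ℕ → Index α) ]
    Injective _≡_ _≡_ g × (∀ n → g n ∉ₗ L) × (∀ n → γ n ∉ₗ L → ∃[ m ] g m ≡ γ n)
  infinite-sequence L γ = g , g-injective , g-avoids , g-covers
    where
    history : ℕ → List (Index α)
    history zero    = L
    history (suc n) = pick (history n) (γ n) ∷ history n

    g : ℕ → Index α
    g n = pick (history n) (γ n)

    ∈-history : ∀ {m n} → m ℕ.<′ n → g m ∈ₗ history n
    ∈-history ℕ.≤′-refl       = here ≡.refl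
    ∈-history (ℕ.≤′-step m<n) = there (∈-history m<n)

    g-≢ : ∀ {m n} → m ℕ.< n → g m ≢ g n
    g-≢ {m} {n} m<n eq =
      pick-∉ (history n) (γ n) (≡.subst (_∈ₗ history n) eq (∈-history (ℕ.<⇒<′ m<n)))

    g-injective : Injective _≡_ _≡_ g
    g-injective {m} {n} eq with ℕ.<-cmp m n
    ... | tri< m<n _ _ = contradiction eq (g-≢ m<n)
    ... | tri≈ _ m≡n _ = m≡n
    ... | tri> _ _ n<m = contradiction (≡.sym eq) (g-≢ n<m)

    L⊆history : ∀ n {i} → i ∈ₗ L → i ∈ₗ history n
    L⊆history zero    p = p
    L⊆history (suc n) p = there (L⊆history n p)

    g-avoids : ∀ n → g n ∉ₗ L
    g-avoids n = pick-∉ (history n) (γ n) ∘ L⊆history n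

    history⊆ : ∀ n {i} → i ∈ₗ history n → i ∉ₗ L → ∃[ m ] g m ≡ i
    history⊆ zero    p         i∉L = contradiction p i∉L
    history⊆ (suc n) (here eq) i∉L = n , ≡.sym eq
    history⊆ (suc n) (there p) i∉L = history⊆ n p i∉L

    g-covers : ∀ n → γ n ∉ₗ L → ∃[ m ] g m ≡ γ n
    g-covers n = history⊆ (suc n) (pick-covers (history n) (γ n))

  module _ (g : ℕ → Index α) (g-injective : Injective _≡_ _≡_ g) where

    private
      -- Hilbert's hotel along g: each `g n` moves one place on, which vacates `g 0`.
      shift : Index α → Index α
      shift j with em {∃[ n ] g n ≡ j}
      ... | yes (n , _) = g (suc n)
      ... | no _        = j

      unshift : Index α → Index α
      unshift j with em {∃[ n ] g (suc n) ≡ j}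
      ... | yes (n , _) = g n
      ... | no _        = j

      unshift-shift : ∀ j → unshift (shift j) ≡ j
      unshift-shift j with em {∃[ n ] g n ≡ j}
      unshift-shift j | yes (n , eq) with em {∃[ m ] g (suc m) ≡ g (suc n)}
      ... | yes (m , eq′) = ≡.trans (≡.cong g (ℕ.suc-injective (g-injective eq′))) eq
      ... | no ¬p         = contradiction (n , ≡.refl) ¬p
      unshift-shift j | no ¬p with em {∃[ m ] g (suc m) ≡ j}
      ... | yes (m , eq′) = contradiction (suc m , eq′) ¬p
      ... | no _          = ≡.refl

      shift-fixes : ∀ {j} → (∀ n → g n ≢ j) → shift j ≡ j
      shift-fixes {j} ∉g with em {∃[ n ] g n ≡ j}
      ... | yes (n , eq) = contradiction eq (∉g n)
      ... | no _         = ≡.refl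

      shift-misses : ∀ j → shift j ≢ g 0
      shift-misses j eq with em {∃[ n ] g n ≡ j}
      ... | yes (n , _) = ℕ.0≢1+n (≡.sym (g-injective eq))
      ... | no ¬p       = ¬p (0 , ≡.sym eq)

    shift-along : Σ[ f ∈ (Index α → Index α) ] Σ[ h ∈ (Index α → Index α) ]
      (∀ j → h (f j) ≡ j) × (∀ {j} → (∀ n → g n ≢ j) → f j ≡ j) × (∀ j → f j ≢ g 0)
    shift-along = shift , unshift , unshift-shift , shift-fixes , shift-misses

  -- The shift runs along a sequence that starts with i and goes on outside L; it therefore fixes L
  -- pointwise and vacates i.
  shift-avoiding : (L : List (Index α)) {i : Index α} → i ∉ₗ L →
    Σ[ f ∈ (Index α → Index α) ] Σ[ h ∈ (Index α → Index α) ]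
    (∀ j → h (f j) ≡ j) × (∀ {j} → j ∈ₗ L → f j ≡ j) × (∀ j → f j ≢ i)
  shift-avoiding L {i} i∉L with infinite-sequence (i ∷ L) (λ _ → i)
  ... | g , g-injective , g-avoids , _ with shift-along g′ g′-injective
    where
    g′ : ℕ → Index α
    g′ zero    = i
    g′ (suc n) = g n

    g′-injective : Injective _≡_ _≡_ g′
    g′-injective {zero}  {zero}  eq = ≡.refl
    g′-injective {zero}  {suc n} eq = contradiction (here (≡.sym eq)) (g-avoids n)
    g′-injective {suc m} {zero}  eq = contradiction (here eq) (g-avoids m)
    g′-injective {suc m} {suc n} eq = ≡.cong suc (g-injective eq)
  ... | f , h , hf , fixes , misses = f , h , hf
    , (λ j∈L → fixes λ { zero    eq → i∉L (≡.subst (_∈ₗ L) (≡.sym eq) j∈L)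
                       ; (suc n) eq → g-avoids n (there (≡.subst (_∈ₗ L) (≡.sym eq) j∈L)) })
    , misses

-- Updates of sequences.

module Update {ℓ : Level} (α : Ordinal ℓ) {U : Set ℓ} where

  open Ordinal α using (_≟_)

  -- α cannot be inferred from the unfolding of Seq α U.
  infixl 10 _⟨_↦_⟩
  _⟨_↦_⟩ : Seq α U → Index α → U → Seq α U
  _⟨_↦_⟩ = _⟨_≔_⟩ {α = α}

  update-same : ∀ (s : Seq α U) {i j u} → j ≡ i → (s ⟨ i ↦ u ⟩) j ≡ u
  update-same s {i} {j} j≡i with j ≟ i
  ... | yes _  = ≡.refl
  ... | no j≢i = contradiction j≡i j≢i

  update-other : ∀ (s : Seq α U) {i j u} → j ≢ i → (s ⟨ i ↦ u ⟩) j ≡ s j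
  update-other s {i} {j} j≢i with j ≟ i
  ... | yes j≡i = contradiction j≡i j≢i
  ... | no _    = ≡.refl

  update-id : ∀ (s : Seq α U) i → s ⟨ i ↦ s i ⟩ ≗ s
  update-id s i j with j ≟ i
  ... | yes ≡.refl = ≡.refl
  ... | no _       = ≡.refl

  update-cong : ∀ {s t : Seq α U} i u → s ≗ t → s ⟨ i ↦ u ⟩ ≗ t ⟨ i ↦ u ⟩
  update-cong i u s≗t j with j ≟ i
  ... | yes _ = ≡.refl
  ... | no _  = s≗t j

  update-overwrite : ∀ (s : Seq α U) i u v → s ⟨ i ↦ u ⟩ ⟨ i ↦ v ⟩ ≗ s ⟨ i ↦ v ⟩
  update-overwrite s i u v j with j ≟ i
  ... | yes _ = ≡.refl
  ... | no _  = ≡.refl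

  update-comm : ∀ (s : Seq α U) {i j} u v → i ≢ j →
                s ⟨ i ↦ u ⟩ ⟨ j ↦ v ⟩ ≗ s ⟨ j ↦ v ⟩ ⟨ i ↦ u ⟩
  update-comm s {i} {j} u v i≢j k with k ≟ i | k ≟ j
  ... | yes ≡.refl | yes ≡.refl = contradiction ≡.refl i≢j
  ... | yes ≡.refl | no _       = ≡.refl
  ... | no _       | yes ≡.refl = ≡.refl
  ... | no _       | no _       = ≡.refl

-- Evaluation of terms, and equations in subalgebras and isomorphic copies.

module _ {ℓ a e : Level} {α : Ordinal ℓ} (A : Algebra α a e) where
  open Algebra A

  eval-cong : ∀ {ρ ρ′ : ℕ → Carrier} → (∀ n → ρ n ≈ᴬ ρ′ n) → ∀ t → ⟦ t ⟧ ρ ≈ᴬ ⟦ t ⟧ ρ′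
  eval-cong eq (var n) = eq n
  eval-cong eq (s + t) = add-cong (eval-cong eq s) (eval-cong eq t)
  eval-cong eq (- t)   = neg-cong (eval-cong eq t)
  eval-cong eq (c i t) = cyl-cong i (eval-cong eq t)
  eval-cong eq (d i j) = Setoid.refl setoid

  eval-subst : ∀ (σ : ℕ → Term α) ρ t → ⟦ t [ σ ] ⟧ ρ ≡ ⟦ t ⟧ (λ n → ⟦ σ n ⟧ ρ)
  eval-subst σ ρ (var n) = ≡.refl
  eval-subst σ ρ (s + t) = ≡.cong₂ add (eval-subst σ ρ s) (eval-subst σ ρ t)
  eval-subst σ ρ (- t)   = ≡.cong neg (eval-subst σ ρ t)
  eval-subst σ ρ (c i t) = ≡.cong (cyl i) (eval-subst σ ρ t)
  eval-subst σ ρ (d i j) = ≡.refl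

  subalgebra-⊨ : ∀ {p} {S : Pred Carrier p} (sub : IsSubuniverse A S) {ε} → A ⊨ ε → subalgebra A sub ⊨ ε
  subalgebra-⊨ {S = S} sub {s ≈ t} valid ρ =
    ≡.subst₂ _≈ᴬ_ (≡.sym (eval-proj₁ s)) (≡.sym (eval-proj₁ t)) (valid (proj₁ ∘ ρ))
    where
    eval-proj₁ : ∀ t → proj₁ (Algebra.⟦_⟧ (subalgebra A sub) t ρ) ≡ ⟦ t ⟧ (proj₁ ∘ ρ)
    eval-proj₁ (var n) = ≡.refl
    eval-proj₁ (s + t) = ≡.cong₂ add (eval-proj₁ s) (eval-proj₁ t)
    eval-proj₁ (- t)   = ≡.cong neg (eval-proj₁ t)
    eval-proj₁ (c i t) = ≡.cong (cyl i) (eval-proj₁ t)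
    eval-proj₁ (d i j) = ≡.refl

module _ {ℓ a e a′ e′ : Level} {α : Ordinal ℓ} {A : Algebra α a e} {B : Algebra α a′ e′} (iso : A ≅ B) where
  private
    module A = Algebra A
    module B = Algebra B
    module I = _≅_ iso

  eval-≅ : ∀ t ρ → I.to (A.⟦ t ⟧ ρ) B.≈ᴬ B.⟦ t ⟧ (I.to ∘ ρ)
  eval-≅ (var n) ρ = B.refl
  eval-≅ (s + t) ρ = B.trans (I.add-homo _ _) (B.add-cong (eval-≅ s ρ) (eval-≅ t ρ))
  eval-≅ (- t)   ρ = B.trans (I.neg-homo _) (B.neg-cong (eval-≅ t ρ))
  eval-≅ (c i t) ρ = B.trans (I.cyl-homo i _) (B.cyl-cong i (eval-≅ t ρ))
  eval-≅ (d i j) ρ = I.diag-homo i j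

  ≅-⊨ : ∀ {ε} → B ⊨ ε → A ⊨ ε
  ≅-⊨ {s ≈ t} valid ρ = Bijection.injective I.bijection
    (B.trans (eval-≅ s ρ) (B.trans (valid (I.to ∘ ρ)) (B.sym (eval-≅ t ρ))))

module _ {ℓ : Level} (α : Ordinal ℓ) where

  -- Equations pass to subalgebras and isomorphic copies, so the theory of `RCA` is determined by
  -- the full set algebras; both halves of the proof work with these alone.
  FullyValid : Pred (Equation α) (lsuc ℓ)
  FullyValid ε = ∀ (U K : Set ℓ) (W : K → Pred U ℓ) → PairwiseDisjointPowers {α = α} K W →
                 fullSetAlgebra (unionOfPowers K W) ⊨ ε

  FullyValid⇒EqTheory : FullyValid ⊆ EqTheory (RCA α)
  FullyValid⇒EqTheory {ε} valid A r = ≅-⊨ isomorphism {ε} (subalgebra-⊨ full isSub {ε} (valid U K W disjoint))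
    where open RCA r

  -- A full algebra belongs to the class as a copy of its improper subalgebra.
  EqTheory⇒FullyValid : EqTheory (RCA α) ⊆ FullyValid
  EqTheory⇒FullyValid {ε} valid U K W disjoint = valid F (record
    { U           = U
    ; K           = K
    ; W           = W
    ; disjoint    = disjoint
    ; S           = λ _ → Lift _ Unit.⊤
    ; isSub       = isSub
    ; isomorphism = record
      { bijection = record
        { to        = λ X → X , _
        ; cong      = λ X≐Y → X≐Y
        ; bijective = (λ X≐Y → X≐Y) , λ Y → proj₁ Y , λ X≐Y → X≐Y
        }
      ; add-homo  = λ X Y → F.refl {F.add X Y}
      ; neg-homo  = λ X → F.refl {F.neg X}
      ; cyl-homo  = λ i X → F.refl {F.cyl i X}
      ; diag-homo = λ i j → F.refl {F.diag i j}
      }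
    })
    where
    F : Algebra α (lsuc ℓ) ℓ
    F = fullSetAlgebra (unionOfPowers K W)
    module F = Algebra F

    isSub : IsSubuniverse F (λ _ → Lift (lsuc ℓ) Unit.⊤)
    isSub = record
      { respects    = λ _ _ → _
      ; add-closed  = λ _ _ → _
      ; neg-closed  = λ _ → _
      ; cyl-closed  = λ _ → _
      ; diag-closed = _
      }

-- Soundness in full set algebras.

module SetAlgebra {ℓ : Level} (em : ExcludedMiddle ℓ) (α : Ordinal ℓ) (infinite : Infinite α)
  (U K : Set ℓ) (W : K → Pred U ℓ) (disjoint : PairwiseDisjointPowers {α = α} K W) where

  open SubsetOf
  open Update α {U}

  V : SeqSet α U
  V = unionOfPowers K W

  F : Algebra α (lsuc ℓ) ℓ
  F = fullSetAlgebra V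

  open Algebra F using (⟦_⟧; _≈ᴬ_; add; neg; cyl; diag)

  inV : Pred (Seq α U) ℓ
  inV = SeqSet.holds V

  resp : ∀ (X : SubsetOf V) {s t} → s ≗ t → members X s → members X t
  resp X = SeqSet.respects (set X)

  respV : ∀ {s t} → s ≗ t → inV s → inV t
  respV = SeqSet.respects V

  -- A common point of two bases gives a constant sequence in both powers, so disjointness of the
  -- powers makes the bases disjoint.
  same-base : ∀ {k l s t i j} → s ∈ SeqSet.holds (power {α = α} (W k)) →
              t ∈ SeqSet.holds (power {α = α} (W l)) → s i ≡ t j → k ≡ l
  same-base {k} {l} {s} {t} {i} {j} p q eq = decidable-stable em λ k≢l →
    disjoint k≢l (λ _ → s i) ((λ _ → p i) , (λ _ → ≡.subst (W l) (≡.sym eq) (q j)))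

  inV-update : ∀ {s t : Seq α U} {j k} → inV s → inV t → s j ≡ t k →
               ∀ i l → inV (s ⟨ i ↦ t l ⟩)
  inV-update {s} {t} (k , p) (k′ , q) eq i l with same-base p q eq
  ... | ≡.refl = k , λ m → helper m
    where
    open Ordinal α using (_≟_)
    helper : ∀ m → W k ((s ⟨ i ↦ t l ⟩) m)
    helper m with m ≟ i
    ... | yes _ = q l
    ... | no _  = p m

  inV-updated : ∀ {s t : Seq α U} {i j u} → inV s → inV t → t i ≡ u → j ≢ i →
                s j ≡ t j → inV (s ⟨ i ↦ u ⟩)
  inV-updated {i = i} p q ≡.refl j≢i eq = inV-update p q eq i i

  -- A coordinate untouched by changes at i and j shows that the changed sequence has the same base
  -- as the original.
  another : ∀ i j → ∃[ k ] k ≢ i × k ≢ j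
  another i j with fresh-index em α infinite (i ∷ j ∷ [])
  ... | k , k∉ = k , (λ k≡i → k∉ (here k≡i)) , (λ k≡j → k∉ (there (here k≡j)))

  -- The definition of `cylindrify` obtains s by changing a member of X. This lemma and the next
  -- turn it round: a change of s at i leads into X.
  cyl-intro : ∀ i (X : SubsetOf V) {s u} → inV s → members X (s ⟨ i ↦ u ⟩) → members (cyl i X) s
  cyl-intro i X {s} {u} v p = v , _ , p , s i ,
    λ j → ≡.sym (≡.trans (update-overwrite s i u (s i) j) (update-id s i j))

  cyl-elim : ∀ i (X : SubsetOf V) {s} → members (cyl i X) s → ∃[ u ] members X (s ⟨ i ↦ u ⟩)
  cyl-elim i X (v , r , p , u , s≗) = r i , resp X
    (λ j → ≡.sym (≡.trans (update-cong i (r i) s≗ j)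
      (≡.trans (update-overwrite r i u (r i) j) (update-id r i j)))) p

  _∩̇_ : SubsetOf V → SubsetOf V → SubsetOf V
  X ∩̇ Y = neg (add (neg X) (neg Y))

  ∩-intro : ∀ {X Y : SubsetOf V} {s} → members X s → members Y s → members (X ∩̇ Y) s
  ∩-intro {X} p q = included X p , λ { (inj₁ (_ , ¬p)) → ¬p p ; (inj₂ (_ , ¬q)) → ¬q q }

  ∩-elim : ∀ (X Y : SubsetOf V) {s} → members (X ∩̇ Y) s → members X s × members Y s
  ∩-elim X Y (v , ¬n) = decidable-stable em (λ ¬p → ¬n (inj₁ (v , ¬p)))
                      , decidable-stable em (λ ¬q → ¬n (inj₂ (v , ¬q)))

  full-intro : ∀ (X : SubsetOf V) {s} → inV s → members (add X (neg X)) s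
  full-intro X {s} v with em {members X s}
  ... | yes p = inj₁ p
  ... | no ¬p = inj₂ (v , ¬p)

  boolean-sound : ∀ {ε} → BooleanAxiom α ε → F ⊨ ε
  boolean-sound +-comm ρ = (λ { (inj₁ p) → inj₂ p ; (inj₂ p) → inj₁ p })
                         , (λ { (inj₁ p) → inj₂ p ; (inj₂ p) → inj₁ p })
  boolean-sound +-assoc ρ =
      (λ { (inj₁ (inj₁ p)) → inj₁ p ; (inj₁ (inj₂ p)) → inj₂ (inj₁ p) ; (inj₂ p) → inj₂ (inj₂ p) })
    , (λ { (inj₁ p) → inj₁ (inj₁ p) ; (inj₂ (inj₁ p)) → inj₁ (inj₂ p) ; (inj₂ (inj₂ p)) → inj₂ p })
  boolean-sound ·-comm ρ = swap (ρ 0) (ρ 1) , swap (ρ 1) (ρ 0)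
    where
    swap : ∀ X Y → members (X ∩̇ Y) ⊆ members (Y ∩̇ X)
    swap X Y p with ∩-elim X Y p
    ... | a , b = ∩-intro {Y} {X} b a
  boolean-sound ·-assoc ρ =
      (λ p → let q , z = ∩-elim (ρ 0 ∩̇ ρ 1) (ρ 2) p ; x , y = ∩-elim (ρ 0) (ρ 1) q in
         ∩-intro {ρ 0} {ρ 1 ∩̇ ρ 2} x (∩-intro {ρ 1} {ρ 2} y z))
    , (λ p → let x , q = ∩-elim (ρ 0) (ρ 1 ∩̇ ρ 2) p ; y , z = ∩-elim (ρ 1) (ρ 2) q in
         ∩-intro {ρ 0 ∩̇ ρ 1} {ρ 2} (∩-intro {ρ 0} {ρ 1} x y) z)
  boolean-sound +-absorbs-· ρ =
    (λ { (inj₁ p) → p ; (inj₂ p) → proj₁ (∩-elim (ρ 0) (ρ 1) p) }) , inj₁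
  boolean-sound ·-absorbs-+ ρ =
      (λ p → proj₁ (∩-elim (ρ 0) (add (ρ 0) (ρ 1)) p))
    , (λ p → ∩-intro {ρ 0} {add (ρ 0) (ρ 1)} p (inj₁ p))
  boolean-sound +-distrib-· ρ =
      (λ { (inj₁ p) → ∩-intro {add (ρ 0) (ρ 1)} {add (ρ 0) (ρ 2)} (inj₁ p) (inj₁ p)
         ; (inj₂ p) → let y , z = ∩-elim (ρ 1) (ρ 2) p in
             ∩-intro {add (ρ 0) (ρ 1)} {add (ρ 0) (ρ 2)} (inj₂ y) (inj₂ z) })
    , (λ p → from (∩-elim (add (ρ 0) (ρ 1)) (add (ρ 0) (ρ 2)) p))
    where
    from : ∀ {s} → members (add (ρ 0) (ρ 1)) s × members (add (ρ 0) (ρ 2)) s →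
           members (add (ρ 0) (ρ 1 ∩̇ ρ 2)) s
    from (inj₁ p , _)      = inj₁ p
    from (inj₂ _ , inj₁ p) = inj₁ p
    from (inj₂ p , inj₂ q) = inj₂ (∩-intro {ρ 1} {ρ 2} p q)
  boolean-sound ·-distrib-+ ρ =
      (λ p → to (∩-elim (ρ 0) (add (ρ 1) (ρ 2)) p))
    , (λ { (inj₁ p) → let x , y = ∩-elim (ρ 0) (ρ 1) p in ∩-intro {ρ 0} {add (ρ 1) (ρ 2)} x (inj₁ y)
         ; (inj₂ p) → let x , z = ∩-elim (ρ 0) (ρ 2) p in ∩-intro {ρ 0} {add (ρ 1) (ρ 2)} x (inj₂ z) })
    where
    to : ∀ {s} → members (ρ 0) s × members (add (ρ 1) (ρ 2)) s →
         members (add (ρ 0 ∩̇ ρ 1) (ρ 0 ∩̇ ρ 2)) s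
    to (x , inj₁ y) = inj₁ (∩-intro {ρ 0} {ρ 1} x y)
    to (x , inj₂ z) = inj₂ (∩-intro {ρ 0} {ρ 2} x z)
  boolean-sound +-complement ρ =
      (λ p → full-intro (ρ 0) (included (add (ρ 1) (neg (ρ 1))) p))
    , (λ p → full-intro (ρ 1) (included (add (ρ 0) (neg (ρ 0))) p))
  boolean-sound ·-complement ρ =
      (λ p → let y , n = ∩-elim (ρ 1) (neg (ρ 1)) p in contradiction y (proj₂ n))
    , (λ (v , ¬p) → contradiction (full-intro (ρ 0) v) ¬p)

  -- The point is that s changed at j alone is still in the unit. A third coordinate k shows that s
  -- changed at both i and j has the base of s, so the new value v at j lies in that base.
  cyl-swap : ∀ {i j} → i ≢ j → ∀ (X : SubsetOf V) → members (cyl i (cyl j X)) ⊆ members (cyl j (cyl i X))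
  cyl-swap {i} {j} i≢j X {s} p with cyl-elim i (cyl j X) p
  ... | u , p′ with cyl-elim j X p′
  ...   | v , q with another i j
  ...     | k , k≢i , k≢j = cyl-intro j (cyl i X) (proj₁ p) (cyl-intro i X
    (inV-updated {j = k} (proj₁ p) q′ (≡.trans (update-other (s ⟨ j ↦ v ⟩) (i≢j ∘ ≡.sym)) (update-same s ≡.refl)) k≢j
      (≡.sym (≡.trans (update-other (s ⟨ j ↦ v ⟩) k≢i) (update-other s k≢j))))
    (resp X (update-comm s u v i≢j) q))
    where
    q′ : inV (s ⟨ j ↦ v ⟩ ⟨ i ↦ u ⟩)
    q′ = included X (resp X (update-comm s u v i≢j) q)

  cylindric-sound : ∀ {ε} → CylindricAxiom α ε → F ⊨ ε
  cylindric-sound (boolean b) = boolean-sound b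
  cylindric-sound (c-comm i≢j) ρ = cyl-swap i≢j (ρ 0) , cyl-swap (i≢j ∘ ≡.sym) (ρ 0)
  cylindric-sound (c-incr {i}) ρ =
    (λ { (inj₁ p) → cyl-intro i (ρ 0) (included (ρ 0) p) (resp (ρ 0) (λ j → ≡.sym (update-id _ i j)) p)
       ; (inj₂ p) → p }) , inj₂
  cylindric-sound (c-idem {i}) ρ =
      (λ {s} p → cyl-intro i (cyl i (ρ 0)) (proj₁ p)
         (resp (cyl i (ρ 0)) (λ j → ≡.sym (update-id s i j)) p))
    , (λ {s} p → let u , q = cyl-elim i (cyl i (ρ 0)) p ; v , r = cyl-elim i (ρ 0) q in
         cyl-intro i (ρ 0) (proj₁ p) (resp (ρ 0) (update-overwrite s i u v) r))
  cylindric-sound (c-+ {i}) ρ =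
      (λ (v , s , p , q) → [ (λ x → inj₁ (v , s , x , q)) , (λ y → inj₂ (v , s , y , q)) ]′ p)
    , (λ { (inj₁ (v , s , x , q)) → v , s , inj₁ x , q ; (inj₂ (v , s , y , q)) → v , s , inj₂ y , q })
  cylindric-sound (c-- {i}) ρ =
      (λ {s} p → let u , (v , ¬q) = cyl-elim i (neg (cyl i (ρ 0))) p in proj₁ p , λ r →
         let w , x = cyl-elim i (ρ 0) r in
         ¬q (cyl-intro i (ρ 0) v (resp (ρ 0) (λ j → ≡.sym (update-overwrite s i u w j)) x)))
    , (λ {s} p → cyl-intro i (neg (cyl i (ρ 0))) (proj₁ p)
         (resp (neg (cyl i (ρ 0))) (λ j → ≡.sym (update-id s i j)) p))
  cylindric-sound (d-refl {i}) ρ = (λ p → full-intro (ρ 0) (proj₁ p))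
    , (λ p → included (add (ρ 0) (neg (ρ 0))) p , ≡.refl)
  cylindric-sound (d-sym i≢j) ρ = (λ (v , p) → v , ≡.sym p) , (λ (v , p) → v , ≡.sym p)
  cylindric-sound (d-trans {i} {j} {k} i≢j j≢k i≢k) ρ =
      (λ {s} p → let u , q = cyl-elim j (diag i j ∩̇ diag j k) p
                     (_ , eq₁) , (_ , eq₂) = ∩-elim (diag i j) (diag j k) q in
         proj₁ p , ≡.trans (≡.sym (update-other s i≢j))
                     (≡.trans eq₁ (≡.trans eq₂ (update-other s (j≢k ∘ ≡.sym)))))
    , (λ {s} (v , eq) → cyl-intro j (diag i j ∩̇ diag j k) {u = s i} v
         (let v′ = inV-update {j = j} v v ≡.refl j i
              eq₁ = ≡.trans (update-other s i≢j) (≡.sym (update-same s ≡.refl))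
              eq₂ = ≡.trans (update-same s ≡.refl) (≡.trans eq (≡.sym (update-other s (j≢k ∘ ≡.sym)))) in
          ∩-intro {diag i j} {diag j k} (v′ , eq₁) (v′ , eq₂)))
  cylindric-sound (c-d {i} {j} i≢j) ρ =
      (λ p → full-intro (ρ 0) (proj₁ p))
    , (λ {s} p → let v = included (add (ρ 0) (neg (ρ 0))) p in
         cyl-intro i (diag i j) {u = s j} v
         (inV-update {j = j} v v ≡.refl i j , ≡.trans (update-same s ≡.refl) (≡.sym (update-other s (i≢j ∘ ≡.sym)))))
  cylindric-sound (d-c {i} {j} i≢j) ρ =
      (λ {s} p → let (v , sᵢ≡sⱼ) , q = ∩-elim (diag i j) (cyl i (diag i j ∩̇ ρ 0)) p
                     u , r = cyl-elim i (diag i j ∩̇ ρ 0) q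
                     (_ , eq) , x = ∩-elim (diag i j) (ρ 0) r
                     -- The inner diagonal makes u equal to the value of s at j, the outer one to
                     -- its value at i; hence the update by u changes nothing.
                     u≡sᵢ = ≡.trans (≡.sym (update-same s ≡.refl))
                              (≡.trans eq (≡.trans (update-other s (i≢j ∘ ≡.sym)) (≡.sym sᵢ≡sⱼ))) in
         ∩-intro {diag i j} {ρ 0} (v , sᵢ≡sⱼ)
           (resp (ρ 0) (λ k → ≡.trans (≡.cong (λ w → (s ⟨ i ↦ w ⟩) k) u≡sᵢ) (update-id s i k)) x))
    , (λ {s} p → ∩-intro {diag i j} {cyl i (diag i j ∩̇ ρ 0)}
         (proj₁ (∩-elim (diag i j) (ρ 0) p))
         (cyl-intro i (diag i j ∩̇ ρ 0) (proj₁ p)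
           (resp (diag i j ∩̇ ρ 0) (λ k → ≡.sym (update-id s i k)) p)))

  -- Precomposing sequences with an injection f which fixes the indices of a
  -- term commutes with the term, and makes every set cylindric along the
  -- indices outside the range of f.

  module _ (f h : Index α → Index α) (h∘f : ∀ j → h (f j) ≡ j) where

    precompose : SubsetOf V → SubsetOf V
    precompose X = record
      { set = record
        { holds    = λ s → inV s × members X (s ∘ f)
        ; respects = λ s≗t (v , p) → respV s≗t v , resp X (s≗t ∘ f) p
        }
      ; included = proj₁
      }

    inV-∘ : ∀ {s} (g : Index α → Index α) → inV s → inV (s ∘ g)
    inV-∘ g (k , p) = k , p ∘ g

    -- As f is injective and fixes i, no coordinate of `s ∘ f` other than i reads position i of s.
    update-∘ : ∀ (s : Seq α U) {i} u → f i ≡ i → (s ⟨ i ↦ u ⟩) ∘ f ≗ (s ∘ f) ⟨ i ↦ u ⟩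
    update-∘ s {i} u fi≡i j with Ordinal._≟_ α j i
    ... | yes ≡.refl = update-same s fi≡i
    ... | no j≢i     = update-other s λ fj≡i →
      j≢i (≡.trans (≡.sym (h∘f j)) (≡.trans (≡.cong h (≡.trans fj≡i (≡.sym fi≡i))) (h∘f i)))

    -- Every s in the unit has the form r ∘ f with r = `s ∘ h` in the unit, so membership of s in X
    -- can be read off at r.
    precompose-injective : ∀ X Y → members (precompose X) ⊆ members (precompose Y) → members X ⊆ members Y
    precompose-injective X Y X⊆Y {s} p = resp Y (λ j → ≡.cong s (h∘f j))
      (proj₂ (X⊆Y (inV-∘ h (included X p) , resp X (λ j → ≡.cong s (≡.sym (h∘f j))) p)))

    precompose-closed : ∀ {i} → (∀ j → f j ≢ i) → ∀ X → cyl i (precompose X) ≈ᴬ precompose X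
    precompose-closed {i} f≢i X =
        (λ {s} p → let u , (_ , q) = cyl-elim i (precompose X) p in
           proj₁ p , resp X (λ j → update-other s (f≢i j)) q)
      , (λ {s} p → cyl-intro i (precompose X) (proj₁ p)
           (resp (precompose X) (λ j → ≡.sym (update-id s i j)) p))

    eval-precompose : ∀ ρ t → (∀ {j} → j occursIn t → f j ≡ j) →
                      ⟦ t ⟧ (precompose ∘ ρ) ≈ᴬ precompose (⟦ t ⟧ ρ)
    eval-precompose ρ (var n) fix = (λ p → p) , (λ p → p)
    eval-precompose ρ (s + t) fix with eval-precompose ρ s (fix ∘ in-+ˡ) | eval-precompose ρ t (fix ∘ in-+ʳ)
    ... | s⊆ , s⊇ | t⊆ , t⊇ =
        (λ { (inj₁ p) → proj₁ (s⊆ p) , inj₁ (proj₂ (s⊆ p))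
           ; (inj₂ p) → proj₁ (t⊆ p) , inj₂ (proj₂ (t⊆ p)) })
      , (λ { (v , inj₁ p) → inj₁ (s⊇ (v , p)) ; (v , inj₂ p) → inj₂ (t⊇ (v , p)) })
    eval-precompose ρ (- t) fix with eval-precompose ρ t (fix ∘ in--)
    ... | t⊆ , t⊇ = (λ (v , ¬p) → v , inV-∘ f v , λ q → ¬p (t⊇ (v , q)))
                  , (λ (v , _ , ¬p) → v , λ q → ¬p (proj₂ (t⊆ q)))
    eval-precompose ρ (c i t) fix with eval-precompose ρ t (fix ∘ in-c)
    ... | t⊆ , t⊇ =
        (λ {s} p → let u , q = cyl-elim i X′ p in
           proj₁ p , cyl-intro i X (inV-∘ f (proj₁ p)) (resp X (update-∘ s u fi≡i) (proj₂ (t⊆ q))))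
      -- The value u lies in the base of s, because `s ∘ f` changed at i keeps the value `s (f j)`
      -- at some j other than i.
      , (λ {s} (v , p) → let u , q = cyl-elim i X p ; j , j≢i , _ = another i i in
           cyl-intro i X′ v (t⊇
             ( ≡.subst (λ w → inV (s ⟨ i ↦ w ⟩)) (update-same (s ∘ f) ≡.refl)
                 (inV-update v (included X q) (≡.sym (update-other (s ∘ f) j≢i)) i i)
             , resp X (λ k → ≡.sym (update-∘ s u fi≡i k)) q)))
      where
      X X′ : SubsetOf V
      X  = ⟦ t ⟧ ρ
      X′ = ⟦ t ⟧ (precompose ∘ ρ)
      fi≡i : f i ≡ i
      fi≡i = fix at-c
    eval-precompose ρ (d i j) fix =
        (λ {s} (v , p) → v , inV-∘ f v ,
           ≡.trans (≡.cong s (fix at-dˡ)) (≡.trans p (≡.cong s (≡.sym (fix at-dʳ)))))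
      , (λ {s} (v , _ , p) → v ,
           ≡.trans (≡.cong s (≡.sym (fix at-dˡ))) (≡.trans p (≡.cong s (fix at-dʳ))))

  inductive-rule-sound : ∀ {s u i} → ¬ (i occursInEq (s ≈ u)) →
    F ⊨ ((s [ (λ n → c i (var n)) ]) ≈ (u [ (λ n → c i (var n)) ])) → F ⊨ (s ≈ u)
  inductive-rule-sound {s} {u} {i} i∉ valid ρ
    with shift-avoiding em α infinite (indices s ++ indices u)
      ([ i∉ ∘ inj₁ ∘ ∈indices⇒occursIn s , i∉ ∘ inj₂ ∘ ∈indices⇒occursIn u ]′ ∘ ∈-++⁻ (indices s))
  ... | f , h , h∘f , fixes , misses =
        precompose-injective f h h∘f (⟦ s ⟧ ρ) (⟦ u ⟧ ρ) (proj₁ agree)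
      , precompose-injective f h h∘f (⟦ u ⟧ ρ) (⟦ s ⟧ ρ) (proj₂ agree)
    where
    module F = Algebra F

    ρ′ : ℕ → SubsetOf V
    ρ′ = precompose f h h∘f ∘ ρ

    instance-≈ : ∀ t → (∀ {j} → j occursIn t → f j ≡ j) →
      ⟦ t [ (λ n → c i (var n)) ] ⟧ ρ′ ≈ᴬ precompose f h h∘f (⟦ t ⟧ ρ)
    instance-≈ t fix = F.trans {X₁} {X₂} {X₄}
      (F.reflexive {X₁} {X₂} (eval-subst F (λ n → c i (var n)) ρ′ t))
      (F.trans {X₂} {X₃} {X₄}
        (eval-cong F (precompose-closed f h h∘f misses ∘ ρ) t)
        (eval-precompose f h h∘f ρ t fix))
      where
      X₁ X₂ X₃ X₄ : SubsetOf V
      X₁ = ⟦ t [ (λ n → c i (var n)) ] ⟧ ρ′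
      X₂ = ⟦ t ⟧ (λ n → cyl i (ρ′ n))
      X₃ = ⟦ t ⟧ ρ′
      X₄ = precompose f h h∘f (⟦ t ⟧ ρ)

    agree : precompose f h h∘f (⟦ s ⟧ ρ) ≈ᴬ precompose f h h∘f (⟦ u ⟧ ρ)
    agree = proj₁ e₂ ∘ proj₁ (valid ρ′) ∘ proj₂ e₁ , proj₁ e₁ ∘ proj₂ (valid ρ′) ∘ proj₂ e₂
      where
      e₁ = instance-≈ s (fixes ∘ ∈-++⁺ˡ ∘ occursIn⇒∈indices)
      e₂ = instance-≈ u (fixes ∘ ∈-++⁺ʳ (indices s) ∘ occursIn⇒∈indices)

module _ {ℓ : Level} (em : ExcludedMiddle ℓ) (α : Ordinal ℓ) (infinite : Infinite α) where

  soundness : IsInductiveCylindricTheory (EqTheory (RCA α))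
  soundness = record
    { axioms = λ {ε} ax → FullyValid⇒EqTheory α {ε} λ U K W disjoint →
        SetAlgebra.cylindric-sound em α infinite U K W disjoint ax
    ; equational-logic = record
      { reflexivity  = λ A _ ρ → Algebra.refl A
      ; symmetry     = λ p A r ρ → Algebra.sym A (p A r ρ)
      ; transitivity = λ p q A r ρ → Algebra.trans A (p A r ρ) (q A r ρ)
      ; replace-+    = λ p q A r ρ → Algebra.add-cong A (p A r ρ) (q A r ρ)
      ; replace--    = λ p A r ρ → Algebra.neg-cong A (p A r ρ)
      ; replace-c    = λ {i} p A r ρ → Algebra.cyl-cong A i (p A r ρ)
      ; substitution = λ {s} {u} σ p A r ρ → ≡.subst₂ (Algebra._≈ᴬ_ A)
          (≡.sym (eval-subst A σ ρ s)) (≡.sym (eval-subst A σ ρ u)) (p A r _)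
      }
    ; inductive-rule = λ {s} {u} i∉ p → FullyValid⇒EqTheory α {s ≈ u} λ U K W disjoint →
        SetAlgebra.inductive-rule-sound em α infinite U K W disjoint i∉
          (EqTheory⇒FullyValid α {(s [ _ ]) ≈ (u [ _ ])} p U K W disjoint)
    }

-- Translation along maps of indices, and derivability.

module _ {a b : Level} {α : Ordinal a} {β : Ordinal b} (g : Index α → Index β) where

  translate : (ℕ → Term β) → Term α → Term β
  translate σ (var n) = σ n
  translate σ (s + t) = translate σ s + translate σ t
  translate σ (- t)   = - translate σ t
  translate σ (c i t) = c (g i) (translate σ t)
  translate σ (d i j) = d (g i) (g j)

  translate-subst : ∀ σ τ {σ′} → (∀ n → σ n [ τ ] ≡ σ′ n) → ∀ t → translate σ t [ τ ] ≡ translate σ′ t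
  translate-subst σ τ eq (var n) = eq n
  translate-subst σ τ eq (s + t) = ≡.cong₂ _+_ (translate-subst σ τ eq s) (translate-subst σ τ eq t)
  translate-subst σ τ eq (- t)   = ≡.cong -_ (translate-subst σ τ eq t)
  translate-subst σ τ eq (c i t) = ≡.cong (c (g i)) (translate-subst σ τ eq t)
  translate-subst σ τ eq (d i j) = ≡.refl

translate-inverse : ∀ {a b} {α : Ordinal a} {β : Ordinal b} (g : Index α → Index β) (h : Index β → Index α) t →
  (∀ {i} → i occursIn t → g (h i) ≡ i) → translate {α = α} {β} g var (translate {α = β} {α} h var t) ≡ t
translate-inverse g h (var n) inv = ≡.refl
translate-inverse g h (s + t) inv =
  ≡.cong₂ _+_ (translate-inverse g h s (inv ∘ in-+ˡ)) (translate-inverse g h t (inv ∘ in-+ʳ))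
translate-inverse g h (- t)   inv = ≡.cong -_ (translate-inverse g h t (inv ∘ in--))
translate-inverse g h (c i t) inv = ≡.cong₂ c (inv at-c) (translate-inverse g h t (inv ∘ in-c))
translate-inverse g h (d i j) inv = ≡.cong₂ d (inv at-dˡ) (inv at-dʳ)

module _ {ℓ : Level} (α : Ordinal ℓ) where

  -- The least inductive theory, as an inductive family at the level of α. This is the level of the
  -- assumed excluded middle, which `henkin` applies to derivable equality, and the family embeds
  -- into theories T of any level.
  data Derivable : Pred (Equation α) ℓ where
    axiom      : ∀ {ε} → CylindricAxiom α ε → Derivable ε
    reflexive  : ∀ {s} → Derivable (s ≈ s)
    symmetric  : ∀ {s u} → Derivable (s ≈ u) → Derivable (u ≈ s)
    transitive : ∀ {s u v} → Derivable (s ≈ u) → Derivable (u ≈ v) → Derivable (s ≈ v)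
    +-congruent : ∀ {s s′ u u′} → Derivable (s ≈ s′) → Derivable (u ≈ u′) → Derivable (s + u ≈ s′ + u′)
    neg-congruent : ∀ {s s′} → Derivable (s ≈ s′) → Derivable (- s ≈ - s′)
    c-congruent : ∀ {i s s′} → Derivable (s ≈ s′) → Derivable (c i s ≈ c i s′)
    substitute  : ∀ {s u} (σ : ℕ → Term α) → Derivable (s ≈ u) → Derivable ((s [ σ ]) ≈ (u [ σ ]))
    induct      : ∀ {s u i} → ¬ (i occursInEq (s ≈ u)) →
      Derivable ((s [ (λ n → c i (var n)) ]) ≈ (u [ (λ n → c i (var n)) ])) → Derivable (s ≈ u)

  Derivable⊆ : ∀ {t} (T : Pred (Equation α) t) → IsInductiveCylindricTheory T → Derivable ⊆ T
  Derivable⊆ T closed = go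
    where
    open IsInductiveCylindricTheory closed
    open ClosedUnderEquationalLogic equational-logic
    go : Derivable ⊆ T
    go (axiom a)         = axioms a
    go reflexive         = reflexivity
    go (symmetric p)     = symmetry (go p)
    go (transitive p q)  = transitivity (go p) (go q)
    go (+-congruent p q) = replace-+ (go p) (go q)
    go (neg-congruent p)   = replace-- (go p)
    go (c-congruent p)   = replace-c (go p)
    go (substitute σ p)  = substitution σ (go p)
    go (induct i∉ p)     = inductive-rule i∉ (go p)

  assign : Term α → Term α → Term α → ℕ → Term α
  assign x y z 0 = x
  assign x y z 1 = y
  assign x y z _ = z

  instantiate : ∀ {s u} → CylindricAxiom α (s ≈ u) → ∀ x y z →
                Derivable ((s [ assign x y z ]) ≈ (u [ assign x y z ]))
  instantiate a x y z = substitute (assign x y z) (axiom a)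

-- The locally finite term algebra.

-- By the inductive rule a variable may be treated as closed under c (g n) for
-- all but finitely many n.  LF is the resulting directed union of theories,
-- presented on the terms whose indices are in the range of g.

module LocallyFinite {ℓ : Level} (α : Ordinal ℓ) (g : ℕ → Index α) (g-injective : Injective _≡_ _≡_ g) (k : ℕ) where

  private
    x₀ : Term α
    x₀ = var 0

  -- The newest cylindrification is innermost, so that substituting it into the variables turns
  -- `close n` of a variable into `close (suc n)` of it; `θ-suc` rests on this.
  close : ℕ → Term α → Term α
  close zero    t = t
  close (suc n) t = close n (c (g (k ℕ.+ n)) t)

  close-subst : ∀ n t σ → close n t [ σ ] ≡ close n (t [ σ ])
  close-subst zero    t σ = ≡.refl
  close-subst (suc n) t σ = close-subst n (c (g (k ℕ.+ n)) t) σ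

  close-cong : ∀ n {s t} → Derivable α (s ≈ t) → Derivable α (close n s ≈ close n t)
  close-cong zero    p = p
  close-cong (suc n) p = close-cong n (c-congruent p)

  c-commute : ∀ i j t → Derivable α (c i (c j t) ≈ c j (c i t))
  c-commute i j t with Ordinal._≟_ α i j
  ... | yes ≡.refl = reflexive
  ... | no i≢j     = instantiate α (c-comm i≢j) t x₀ x₀

  c-close : ∀ i n t → Derivable α (c i (close n t) ≈ close n (c i t))
  c-close i zero    t = reflexive
  c-close i (suc n) t = transitive (c-close i n _) (close-cong n (c-commute i (g (k ℕ.+ n)) t))

  c-close-closed : ∀ n t → Derivable α (c (g (k ℕ.+ n)) (close (suc n) t) ≈ close (suc n) t)
  c-close-closed n t = transitive (c-close (g (k ℕ.+ n)) n _)
    (close-cong n (symmetric (instantiate α c-idem t x₀ x₀)))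

  θ : ℕ → Term ω → Term α
  θ n = translate g (close n ∘ var)

  θ-suc : ∀ n t → θ n t [ (λ m → c (g (k ℕ.+ n)) (var m)) ] ≡ θ (suc n) t
  θ-suc n = translate-subst g (close n ∘ var) σ (λ m → close-subst n (var m) σ)
    where
    σ : ℕ → Term α
    σ m = c (g (k ℕ.+ n)) (var m)

  infix 4 _≋_
  record _≋_ (s t : Term ω) : Set ℓ where
    constructor at
    field
      stage      : ℕ
      derivation : Derivable α (θ stage s ≈ θ stage t)

  -- The passage to the next stage is an instance of the substitution rule. The way back, in
  -- `conservative`, is the inductive rule.
  θ-mono-suc : ∀ n s t → Derivable α (θ n s ≈ θ n t) → Derivable α (θ (suc n) s ≈ θ (suc n) t)
  θ-mono-suc n s t p = ≡.subst₂ (λ u v → Derivable α (u ≈ v)) (θ-suc n s) (θ-suc n t) (substitute _ p)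

  θ-mono : ∀ {m n} s t → m ℕ.≤′ n → Derivable α (θ m s ≈ θ m t) → Derivable α (θ n s ≈ θ n t)
  θ-mono s t ℕ.≤′-refl       p = p
  θ-mono s t (ℕ.≤′-step {n = n} m≤n) p = θ-mono-suc n s t (θ-mono s t m≤n p)

  lift₂ : ∀ {s t u v x y} →
    (∀ n → Derivable α (θ n s ≈ θ n t) → Derivable α (θ n u ≈ θ n v) → Derivable α (θ n x ≈ θ n y)) →
    s ≋ t → u ≋ v → x ≋ y
  lift₂ {s} {t} {u} {v} f (at m p) (at n q) = at (m ⊔ n) (f (m ⊔ n)
    (θ-mono s t (ℕ.≤⇒≤′ (ℕ.m≤m⊔n m n)) p) (θ-mono u v (ℕ.≤⇒≤′ (ℕ.m≤n⊔m m n)) q))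

  setoid : Setoid 0ℓ ℓ
  setoid = record
    { Carrier       = Term ω
    ; _≈_           = _≋_
    ; isEquivalence = record
      { refl  = at 0 reflexive
      ; sym   = λ (at n p) → at n (symmetric p)
      ; trans = lift₂ λ _ → transitive
      }
    }

  +-cong : ∀ {s t u v} → s ≋ t → u ≋ v → s + u ≋ t + v
  +-cong = lift₂ λ _ → +-congruent

  neg-cong : ∀ {s t} → s ≋ t → - s ≋ - t
  neg-cong (at n p) = at n (neg-congruent p)

  ·-cong : ∀ {s t u v} → s ≋ t → u ≋ v → s · u ≋ t · v
  ·-cong = lift₂ λ _ p q → neg-congruent (+-congruent (neg-congruent p) (neg-congruent q))

  ax₃ : ∀ {s u} → BooleanAxiom α (s ≈ u) → ∀ x y z →
        Derivable α ((s [ assign α (θ 0 x) (θ 0 y) (θ 0 z) ]) ≈ (u [ assign α (θ 0 x) (θ 0 y) (θ 0 z) ]))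
  ax₃ a x y z = instantiate α (boolean a) (θ 0 x) (θ 0 y) (θ 0 z)

  booleanAlgebra : BooleanAlgebra 0ℓ ℓ
  booleanAlgebra = record
    { Carrier = Term ω
    ; _≈_     = _≋_
    ; _∨_     = _+_
    ; _∧_     = _·_
    ; ¬_      = -_
    ; ⊤       = 𝟙
    ; ⊥       = 𝟘
    ; isBooleanAlgebra = record
      { isDistributiveLattice = record
        { isLattice = record
          { isEquivalence = Setoid.isEquivalence setoid
          ; ∨-comm        = ∨-comm
          ; ∨-assoc       = λ x y z → at 0 (ax₃ +-assoc x y z)
          ; ∨-cong        = +-cong
          ; ∧-comm        = ∧-comm
          ; ∧-assoc       = λ x y z → at 0 (ax₃ ·-assoc x y z)
          ; ∧-cong        = ·-cong
          ; absorptive    = (λ x y → at 0 (ax₃ +-absorbs-· x y y)) , (λ x y → at 0 (ax₃ ·-absorbs-+ x y y))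
          }
        ; ∨-distrib-∧ = comm∧distrˡ⇒distr setoid ·-cong ∨-comm
            (λ x y z → at 0 (ax₃ +-distrib-· x y z))
        ; ∧-distrib-∨ = comm∧distrˡ⇒distr setoid +-cong ∧-comm
            (λ x y z → at 0 (ax₃ ·-distrib-+ x y z))
        }
      -- The complement axioms speak about variable 1, while 𝟙 and 𝟘 contain variable 0; putting
      -- `var 0` for the latter leaves 𝟙 and 𝟘 as they are.
      ; ∨-complement = comm∧invʳ⇒inv setoid {e = 𝟙} ∨-comm (λ x → at 0 (ax₃ +-complement (var 0) x x))
      ; ∧-complement = comm∧invʳ⇒inv setoid {e = 𝟘} ∧-comm (λ x → at 0 (ax₃ ·-complement (var 0) x x))
      ; ¬-cong       = neg-cong
      }
    }
    where
    ∨-comm : ∀ x y → x + y ≋ y + x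
    ∨-comm x y = at 0 (ax₃ +-comm x y y)

    ∧-comm : ∀ x y → x · y ≋ y · x
    ∧-comm x y = at 0 (ax₃ ·-comm x y y)

  LF : CylindricAlgebra ℕ 0ℓ ℓ
  LF = record
    { _≟_            = ℕ._≟_
    ; booleanAlgebra = booleanAlgebra
    ; cyl            = c
    ; diag           = d
    ; cyl-cong       = λ i (at n p) → at n (c-congruent p)
    ; cyl-comm       = λ i≢j x → at 0 (instantiate α (c-comm (i≢j ∘ g-injective)) (θ 0 x) x₀ x₀)
    ; cyl-incr       = λ i x → at 0 (instantiate α c-incr (θ 0 x) x₀ x₀)
    ; cyl-idem       = λ i x → at 0 (instantiate α c-idem (θ 0 x) x₀ x₀)
    ; cyl-∨          = λ i x y → at 0 (instantiate α c-+ (θ 0 x) (θ 0 y) x₀)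
    ; cyl-∼          = λ i x → at 0 (instantiate α c-- (θ 0 x) x₀ x₀)
    ; diag-refl      = λ i → at 0 (axiom d-refl)
    ; diag-sym       = λ i≢j → at 0 (axiom (d-sym (i≢j ∘ g-injective)))
    ; diag-trans     = λ i≢j j≢k i≢k →
        at 0 (axiom (d-trans (i≢j ∘ g-injective) (j≢k ∘ g-injective) (i≢k ∘ g-injective)))
    ; cyl-diag       = λ i≢j → at 0 (axiom (c-d (i≢j ∘ g-injective)))
    ; diag-cyl       = λ i≢j x → at 0 (instantiate α (d-c (i≢j ∘ g-injective)) (θ 0 x) x₀ x₀)
    }

  open CylindricAlgebra LF using (Closed; ∨-closed; ∼-closed; cyl-preserves-closed; diag-closed)

  bound-closed : ∀ t {p} → k ℕ.≤ p → bound t ℕ.≤ p → Closed p t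
  -- The cylindrification by `g p` is the one added in passing from stage p - k to the next, whence
  -- the successor.
  bound-closed (var n) {p} k≤p b≤p = at (suc (p ∸ k)) (
    ≡.subst (λ q → Derivable α (c (g q) (close (suc (p ∸ k)) (var n)) ≈ close (suc (p ∸ k)) (var n)))
      (ℕ.m+[n∸m]≡n k≤p) (c-close-closed (p ∸ k) (var n)))
  bound-closed (s + t) k≤p b≤p = ∨-closed 
    (bound-closed s k≤p (ℕ.≤-trans (ℕ.m≤m⊔n _ _) b≤p)) (bound-closed t k≤p (ℕ.≤-trans (ℕ.m≤n⊔m _ _) b≤p))
  bound-closed (- t) k≤p b≤p = ∼-closed (bound-closed t k≤p b≤p)
  bound-closed (c i t) k≤p b≤p =
    cyl-preserves-closed i (bound-closed t k≤p (ℕ.≤-trans (ℕ.m≤n⊔m (suc i) (bound t)) b≤p))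
  bound-closed (d i j) k≤p b≤p = diag-closed
    (ℕ.<⇒≢ (ℕ.≤-trans (ℕ.m≤m⊔n (suc i) (suc j)) b≤p) ∘ ≡.sym)
    (ℕ.<⇒≢ (ℕ.≤-trans (ℕ.m≤n⊔m (suc i) (suc j)) b≤p) ∘ ≡.sym)

  LF-isCountableLocallyFinite : IsCountableLocallyFinite LF
  LF-isCountableLocallyFinite = record
    { enum            = enumTerm
    ; enum-surjective = enumTerm-surjective
    ; bound           = λ t → k ⊔ bound t
    ; bound-closed    = λ t b≤p →
        bound-closed t (ℕ.≤-trans (ℕ.m≤m⊔n k _) b≤p) (ℕ.≤-trans (ℕ.m≤n⊔m k _) b≤p)
    }

  occurs-close : ∀ n {t j} → j occursIn close n t → j occursIn t ⊎ ∃[ m ] m ℕ.< n × g (k ℕ.+ m) ≡ j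
  occurs-close zero    p = inj₁ p
  occurs-close (suc n) p with occurs-close n p
  ... | inj₁ at-c           = inj₂ (n , ℕ.n<1+n n , ≡.refl)
  ... | inj₁ (in-c q)       = inj₁ q
  ... | inj₂ (m , m<n , eq) = inj₂ (m , ℕ.m<n⇒m<1+n m<n , eq)

  occurs-θ : ∀ n t {j} → j occursIn θ n t →
    (∃[ i ] i ℕ.< bound t × g i ≡ j) ⊎ ∃[ m ] m ℕ.< n × g (k ℕ.+ m) ≡ j
  occurs-θ n (var m) p with occurs-close n p
  ... | inj₂ q = inj₂ q
  occurs-θ n (s + t) (in-+ˡ p) with occurs-θ n s p
  ... | inj₁ (i , i< , eq) = inj₁ (i , ℕ.<-≤-trans i< (ℕ.m≤m⊔n _ _) , eq)
  ... | inj₂ q             = inj₂ q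
  occurs-θ n (s + t) (in-+ʳ p) with occurs-θ n t p
  ... | inj₁ (i , i< , eq) = inj₁ (i , ℕ.<-≤-trans i< (ℕ.m≤n⊔m _ _) , eq)
  ... | inj₂ q             = inj₂ q
  occurs-θ n (- t) (in-- p) = occurs-θ n t p
  occurs-θ n (c i t) at-c = inj₁ (i , ℕ.m≤m⊔n (suc i) (bound t) , ≡.refl)
  occurs-θ n (c i t) (in-c p) with occurs-θ n t p
  ... | inj₁ (j , j< , eq) = inj₁ (j , ℕ.<-≤-trans j< (ℕ.m≤n⊔m (suc i) _) , eq)
  ... | inj₂ q             = inj₂ q
  occurs-θ n (d i j) at-dˡ = inj₁ (i , ℕ.m≤m⊔n (suc i) (suc j) , ≡.refl)
  occurs-θ n (d i j) at-dʳ = inj₁ (j , ℕ.m≤n⊔m (suc i) (suc j) , ≡.refl)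

  -- The indices at stage n are `g i` with i < k, from the term itself, and `g (k + m)` with m < n,
  -- from the closed variables. So the inductive rule applies with `g (k + n)`.
  fresh-θ : ∀ n t → bound t ℕ.≤ k → ¬ (g (k ℕ.+ n) occursIn θ n t)
  fresh-θ n t b≤k p with occurs-θ n t p
  ... | inj₁ (i , i<b , eq) =
    ℕ.<⇒≢ (ℕ.<-≤-trans i<b (ℕ.≤-trans b≤k (ℕ.m≤m+n k n))) (g-injective eq)
  ... | inj₂ (m , m<n , eq) = ℕ.<⇒≢ m<n (ℕ.+-cancelˡ-≡ k m n (g-injective eq))

  conservative : ∀ {s t} → bound s ℕ.≤ k → bound t ℕ.≤ k → s ≋ t →
                 Derivable α (translate g var s ≈ translate g var t)
  conservative {s} {t} s≤k t≤k (at n p) = go n p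
    where
    go : ∀ n → Derivable α (θ n s ≈ θ n t) → Derivable α (θ 0 s ≈ θ 0 t)
    go zero    p = p
    go (suc n) p = go n (induct [ fresh-θ n s s≤k , fresh-θ n t t≤k ]′
      (≡.subst₂ (λ u v → Derivable α (u ≈ v)) (≡.sym (θ-suc n s)) (≡.sym (θ-suc n t)) p))

-- The Henkin model of an ultrafilter.

least : ∀ {ℓ} → ExcludedMiddle ℓ → (P : Pred ℕ ℓ) → ∃[ n ] P n → ∃[ m ] P m × (∀ n → P n → m ℕ.≤ n)
least em P (n , p) = <-rec (λ n → P n → ∃[ m ] P m × (∀ n → P n → m ℕ.≤ n)) descend n p
  where
  descend : ∀ n → (∀ {m} → m ℕ.< n → P m → ∃[ l ] P l × (∀ n → P n → l ℕ.≤ n)) →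
            P n → ∃[ l ] P l × (∀ n → P n → l ℕ.≤ n)
  descend n rec p with em {∃[ m ] m ℕ.< n × P m}
  ... | yes (m , m<n , q) = rec m<n q
  ... | no none           = n , p , λ m q → ℕ.≮⇒≥ λ m<n → none (m , m<n , q)

-- The Henkin model of an ultrafilter: its base consists of the least elements
-- p ≥ k of the classes of the relation diag p q ∈ filter.

module Model {ℓ : Level} (em : ExcludedMiddle ℓ) (α : Ordinal ℓ) (infinite : Infinite α)
  (g : ℕ → Index α) (g-injective : Injective _≡_ _≡_ g) (k : ℕ)
  (𝔘 : HenkinUltrafilter (LocallyFinite.LF α g g-injective k) k) where

  open LocallyFinite α g g-injective k using (LF)
  open CylindricAlgebra LF hiding (Carrier; _≟_)
  open HenkinUltrafilter 𝔘
  open Substitution LF k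

  -- Representatives take the place of equivalence classes because `diagonal` compares values by
  -- `≡`.
  Canonical : Pred ℕ ℓ
  Canonical p = k ℕ.≤ p × (∀ q → k ℕ.≤ q → filter (d q p) → p ℕ.≤ q)

  d-filter-sym : ∀ {p q} → filter (d p q) → filter (d q p)
  d-filter-sym = resp (diag-symm _ _)

  d-filter-trans : ∀ {p q r} → filter (d p q) → filter (d q r) → filter (d p r)
  d-filter-trans x y = upward (diag-⊑-trans _ _ _) (meet x y)

  canonical-unique : ∀ {p q} → Canonical p → Canonical q → filter (d p q) → p ≡ q
  canonical-unique (k≤p , p-least) (k≤q , q-least) x =
    ℕ.≤-antisym (p-least _ k≤q (d-filter-sym x)) (q-least _ k≤p x)

  -- Indices below k also need a representative among the constants. The unit equals
  -- `cyl (suc n) (d (suc n) n)`, and a witness for it is some p from k on which the filter equates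
  -- with n; `suc n` serves as an index different from n.
  canonical : ∀ n → ∃[ p ] Canonical p × filter (d n p)
  canonical n with witnessed {suc n} {d (suc n) n} (resp (sym (cyl-diag ℕ.1+n≢n)) ⊤-filter)
  ... | p , k≤p , n≢p , x with least em (λ q → k ℕ.≤ q × filter (d n q))
          (p , k≤p , d-filter-sym (resp (sub-diagˡ n≢p ℕ.1+n≢n) x))
  ...   | q , (k≤q , y) , q-least =
    q , (k≤q , λ r k≤r z → q-least r (k≤r , d-filter-trans y (d-filter-sym z))) , y

  U : Set ℓ
  U = Lift ℓ ℕ

  -- With a single base the unit is one power, and disjointness is trivial.
  W : Lift ℓ Unit.⊤ → Pred U ℓ
  W _ (lift p) = Canonical p

  open Update α {U}
  open SetAlgebra em α infinite U (Lift ℓ Unit.⊤) W (λ k≢l → contradiction ≡.refl k≢l)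
    using (V; F; inV; respV; cyl-intro; cyl-elim)
  open Algebra F using (⟦_⟧)
  open SubsetOf using (members; included)

  values : Seq α U → ℕ → ℕ
  values s n = lower (s (g n))

  above : ∀ {s} → inV s → Above (values s)
  above (_ , v) n = proj₁ (v (g n))

  ρ : ℕ → SubsetOf V
  ρ n = record
    { set = record
      { holds    = λ s → inV s × filter (subs k (values s) (var n))
      ; respects = λ s≗t (v , p) → respV s≗t v ,
          ≡.subst filter (subs-ext k (λ {m} _ → ≡.cong lower (s≗t (g m))) (var n)) p
      }
    ; included = proj₁
    }

  ι : Term ω → Term α
  ι = translate g var

  truth : ∀ t → bound t ℕ.≤ k → ∀ {s} → inV s →
    (members (⟦ ι t ⟧ ρ) s → filter (subs k (values s) t)) ×
    (filter (subs k (values s) t) → members (⟦ ι t ⟧ ρ) s)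
  truth (var n) b≤k v = proj₂ , (v ,_)
  truth (t + u) b≤k {s} v =
      resp (sym (subs-∨ k _ t u)) ∘ [ upward (x≤x∨y _ _) ∘ proj₁ T , upward (y≤x∨y _ _) ∘ proj₁ T′ ]′
    , [ inj₁ ∘ proj₂ T , inj₂ ∘ proj₂ T′ ]′ ∘ prime ∘ resp (subs-∨ k _ t u)
    where
    T  = truth t (ℕ.≤-trans (ℕ.m≤m⊔n _ _) b≤k) v
    T′ = truth u (ℕ.≤-trans (ℕ.m≤n⊔m _ _) b≤k) v
  truth (- t) b≤k {s} v =
      (λ (_ , ¬p) → resp (sym (subs-∼ (above v) ℕ.≤-refl t)) (¬⇒∼ (¬p ∘ proj₂ T)))
    , (λ p → v , ∼⇒¬ (resp (subs-∼ (above v) ℕ.≤-refl t) p) ∘ proj₁ T)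
    where
    T = truth t b≤k v
  truth (c i t) b≤k {s} v = to , from
    where
    X : SubsetOf V
    X = ⟦ ι t ⟧ ρ

    i<k : i ℕ.< k
    i<k = ℕ.≤-trans (ℕ.m≤m⊔n (suc i) (bound t)) b≤k

    T : ∀ {s} → inV s → (members X s → filter (subs k (values s) t)) ×
                        (filter (subs k (values s) t) → members X s)
    T = truth t (ℕ.≤-trans (ℕ.m≤n⊔m (suc i) (bound t)) b≤k)

    -- In ψ the index i is still free, so one ψ serves for all values that may be put at `g i`.
    subs-c = subs-cyl ℕ.≤-refl i<k (above v) t

    ψ : Term ω
    ψ = proj₁ subs-c

    unchanged : ∀ u {j} → j ≢ i → values s j ≡ values (s ⟨ g i ↦ u ⟩) j
    unchanged u j≢i = ≡.cong lower (≡.sym (update-other s (j≢i ∘ g-injective)))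

    S-update : ∀ {u} → inV (s ⟨ g i ↦ u ⟩) → subs k (values (s ⟨ g i ↦ u ⟩)) t ≋ sub i (lower u) ψ
    S-update {u} v′ = ≡.subst (λ p → subs k (values (s ⟨ g i ↦ u ⟩)) t ≋ sub i p ψ)
      (≡.cong lower (update-same s ≡.refl))
      (proj₂ (proj₂ subs-c) (above v′) (unchanged u))

    to : members (⟦ ι (c i t) ⟧ ρ) s → filter (subs k (values s) (c i t))
    to p =
      let u , q = cyl-elim (g i) X p
          v′    = included X q
      in resp (sym (proj₁ (proj₂ subs-c)))
           (upward (sub-⊑-cyl i (lower u) ψ) (resp (S-update v′) (proj₁ (T v′) q)))

    inV-canonical : ∀ {q} → Canonical q → inV (s ⟨ g i ↦ lift q ⟩)
    inV-canonical {q} q-canonical = _ , update-canonical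
      where
      update-canonical : ∀ j → Canonical (lower ((s ⟨ g i ↦ lift q ⟩) j))
      update-canonical j with Ordinal._≟_ α j (g i)
      ... | yes _ = q-canonical
      ... | no _  = proj₂ v j

    from : filter (subs k (values s) (c i t)) → members (⟦ ι (c i t) ⟧ ρ) s
    -- The witness p need not lie in the base; it is replaced by its representative q by means of
    -- `sub-diag-⊑`.
    from x =
      let p , k≤p , i≢p , y   = witnessed (resp (proj₁ (proj₂ subs-c)) x)
          q , q-canonical , z = canonical p
          v′                  = inV-canonical q-canonical
          i≢q                 = ℕ.<⇒≢ (ℕ.<-≤-trans i<k (proj₁ q-canonical))
      in cyl-intro (g i) X v (proj₂ (T v′) (resp (sym (S-update v′))
           (upward (sub-diag-⊑ i≢p i≢q ψ) (meet y z))))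
  truth (d i j) b≤k {s} v =
      (λ (_ , eq) → resp (sym S-d) (resp (sym (diag-⊤ (≡.cong lower eq))) ⊤-filter))
    , (λ x → v , ≡.cong lift (canonical-unique (proj₂ v (g i)) (proj₂ v (g j)) (resp S-d x)))
    where
    S-d = subs-diag-< (above v) (ℕ.≤-trans (ℕ.m≤m⊔n (suc i) (suc j)) b≤k)
      (ℕ.≤-trans (ℕ.m≤n⊔m (suc i) (suc j)) b≤k)

  -- Coordinate `g n` receives the constant that the filter equates with n. Coordinates outside the
  -- range of g receive that of 0 as a default.
  base : ∀ (i : Index α) → Σ[ u ∈ U ] Canonical (lower u) × (∀ n → g n ≡ i → filter (d n (lower u)))
  base i with em {∃[ n ] g n ≡ i}
  ... | no none        = lift (proj₁ (canonical 0)) , proj₁ (proj₂ (canonical 0)) , λ n eq → contradiction (n , eq) none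
  ... | yes (n , gn≡i) = lift (proj₁ (canonical n)) , proj₁ (proj₂ (canonical n)) ,
    λ m gm≡i → ≡.subst (λ l → filter (d l (proj₁ (canonical n))))
      (g-injective (≡.trans gn≡i (≡.sym gm≡i))) (proj₂ (proj₂ (canonical n)))

  point : Seq α U
  point = proj₁ ∘ base

  inV-point : inV point
  inV-point = _ , proj₁ ∘ proj₂ ∘ base

  -- Each index m is replaced by a constant with `d m (values point m)` in the filter, so every
  -- replacement stays in the filter. With `truth`, `point` satisfies all terms of the filter with
  -- bound at most k.
  subs-point : ∀ m {t} → filter t → filter (subs m (values point) t)
  subs-point zero    x = x
  subs-point (suc m) x = subs-point m
    (upward (diag-∧-⊑-sub m _ _) (meet (proj₂ (proj₂ (base (g m))) m ≡.refl) x))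

-- Completeness.

module _ {ℓ : Level} (em : ExcludedMiddle ℓ) (α : Ordinal ℓ) (infinite : Infinite α) where

  module _ (g : ℕ → Index α) (g-injective : Injective _≡_ _≡_ g) where

    complete-on-range : ∀ s t → FullyValid α (translate g var s ≈ translate g var t) →
                        Derivable α (translate g var s ≈ translate g var t)
    complete-on-range s t valid = conservative s≤k t≤k
      (⊑-antisym (≤-in-models s t s≤k t≤k λ 𝔘 → proj₁ (valid-in 𝔘)) (≤-in-models t s t≤k s≤k λ 𝔘 → proj₂ (valid-in 𝔘)))
      where
      k : ℕ
      k = bound s ⊔ bound t
      s≤k : bound s ℕ.≤ k
      s≤k = ℕ.m≤m⊔n (bound s) (bound t)
      t≤k : bound t ℕ.≤ k
      t≤k = ℕ.m≤n⊔m (bound s) (bound t)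

      open LocallyFinite α g g-injective k using (LF; LF-isCountableLocallyFinite; conservative)
      open CylindricAlgebra LF using (_⊑_; ⊑-antisym; ∧-∼-⊥⇒⊑; x∧y≤x; x∧y≤y)
      open Model em α infinite g g-injective k using (ρ; truth; point; inV-point; subs-point; ι)

      eval : HenkinUltrafilter LF k → Term ω → Pred (Seq α (Lift ℓ ℕ)) ℓ
      eval 𝔘 u = SubsetOf.members (Algebra.⟦_⟧ (fullSetAlgebra _) (ι 𝔘 u) (ρ 𝔘))

      valid-in : ∀ 𝔘 → eval 𝔘 s ⊆ eval 𝔘 t × eval 𝔘 t ⊆ eval 𝔘 s
      valid-in 𝔘 = valid _ _ _ (λ k≢l → contradiction ≡.refl k≢l) (ρ 𝔘)

      -- If u is not below v, then `u · - v` is nonzero and lies in a Henkin ultrafilter, and the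
      -- point of its model satisfies u but not v.
      ≤-in-models : ∀ u v → bound u ℕ.≤ k → bound v ℕ.≤ k →
                    (∀ 𝔘 → eval 𝔘 u ⊆ eval 𝔘 v) → u ⊑ v
      ≤-in-models u v u≤k v≤k u⊆v = ∧-∼-⊥⇒⊑ (decidable-stable em λ u∧∼v≭⊥ →
        let 𝔘 , x = henkin em LF-isCountableLocallyFinite k u∧∼v≭⊥
            open HenkinUltrafilter 𝔘 using (upward; ∼⇒¬; resp)
            open Substitution LF k using (subs-∼)
            p = proj₂ (truth 𝔘 u u≤k (inV-point 𝔘)) (subs-point 𝔘 k (upward (x∧y≤x u (- v)) x))
        in ∼⇒¬ (resp (subs-∼ (Model.above em α infinite g g-injective k 𝔘 (inV-point 𝔘)) ℕ.≤-refl v)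
                  (subs-point 𝔘 k (upward (x∧y≤y u (- v)) x)))
             (proj₁ (truth 𝔘 v v≤k (inV-point 𝔘)) (u⊆v 𝔘 p)))

  private
    nth : Index α → List (Index α) → ℕ → Index α
    -- Past the end of the list the default is repeated; `infinite-sequence` puts fresh indices in
    -- place of repetitions.
    nth i []       n       = i
    nth i (j ∷ js) zero    = j
    nth i (j ∷ js) (suc n) = nth i js n

    ∈⇒nth : ∀ i {j js} → j ∈ₗ js → ∃[ n ] nth i js n ≡ j
    ∈⇒nth i (here eq) = 0 , ≡.sym eq
    ∈⇒nth i (there p) = let n , eq = ∈⇒nth i p in suc n , eq

  sequence-covering : (L : List (Index α)) → Σ[ g ∈ (ℕ → Index α) ]
    Injective _≡_ _≡_ g × (∀ {i} → i ∈ₗ L → ∃[ n ] g n ≡ i)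
  sequence-covering L with fresh-index em α infinite []
  ... | i₀ , _ with infinite-sequence em α infinite [] (nth i₀ L)
  ...   | g , g-injective , _ , covers = g , g-injective , λ i∈L →
    let n , eq = ∈⇒nth i₀ i∈L ; m , eq′ = covers n λ () in m , ≡.trans eq′ eq

  -- With g running through all indices of s and t, the equation is the translation of an equation
  -- over ω, to which `complete-on-range` applies.
  completeness : EqTheory (RCA α) ⊆ Derivable α
  completeness {s ≈ t} valid with sequence-covering (indices s ++ indices t)
  ... | g , g-injective , covers = ≡.subst₂ (λ u v → Derivable α (u ≈ v)) s-back t-back
    (complete-on-range g g-injective (pull s) (pull t)
      (≡.subst₂ (λ u v → FullyValid α (u ≈ v)) (≡.sym s-back) (≡.sym t-back)
        (EqTheory⇒FullyValid α {s ≈ t} valid)))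
    where
    h : Index α → ℕ
    h i with em {∃[ n ] g n ≡ i}
    ... | yes (n , _) = n
    -- The default is harmless: every index of s and t is in the range of g.
    ... | no _        = 0

    g∘h : ∀ {i} → ∃[ n ] g n ≡ i → g (h i) ≡ i
    g∘h {i} p with em {∃[ n ] g n ≡ i}
    ... | yes (n , eq) = eq
    ... | no ¬p        = contradiction p ¬p

    pull : Term α → Term ω
    pull = translate h var

    s-back : translate g var (pull s) ≡ s
    s-back = translate-inverse g h s (g∘h ∘ covers ∘ ∈-++⁺ˡ ∘ occursIn⇒∈indices)

    t-back : translate g var (pull t) ≡ t
    t-back = translate-inverse g h t (g∘h ∘ covers ∘ ∈-++⁺ʳ (indices s) ∘ occursIn⇒∈indices)

corollary4p3 : ∀ {ℓ t : Level} → ExcludedMiddle ℓ →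
    (α : Ordinal ℓ) → Infinite α →
    IsInductiveCylindricTheory (EqTheory (RCA α)) ×
    ((T : Pred (Equation α) t) → IsInductiveCylindricTheory T → EqTheory (RCA α) ⊆ T)
corollary4p3 em α infinite = soundness em α infinite ,
  λ T T-closed {ε} → Derivable⊆ α T T-closed ∘ completeness em α infinite {ε}
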